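{- We have \[ \sum_{k = 1}^{\infty} \sum_{j = k}^{\infty} \frac{1}{k^2} \, \frac{1}{j \, 2^j} = \frac{5}{8}\, \zeta(3). \]
   Context: $\zeta$ denotes the Riemann zeta function, so $\zeta(3) = \sum_{n=1}^\infty 1/n^3$. -}

module Defs where

open import Data.Nat as ℕ using (ℕ; zero; suc; NonZero; NonTrivial)
import Data.Nat.Properties as ℕ
open import Data.Integer as ℤ using (+_; +<+; +≤+)
import Data.Integer.Properties as ℤ
import Data.Integer.Tactic.RingSolver as ℤ-Solver
open import Data.Product using (∃-syntax; _×_; _,_; proj₁; proj₂)
open import Data.Rational
  using (ℚ; mkℚ; 0ℚ; 1ℚ; ½; _/_; _+_; _*_; _-_; -_; ∣_∣; _≤_; _<_; *<*; 1/_;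
         Positive; positive; nonNegative; toℚᵘ)
open import Data.Rational.Properties
open import Data.Rational.Solver using (module +-*-Solver)
open import Data.Rational.Unnormalised as ℚᵘ using (mkℚᵘ)
import Data.Rational.Unnormalised.Properties as ℚᵘ
open import Data.Sum using (inj₁; inj₂)
open import Function using (case_of_; it)
open import Relation.Binary.PropositionalEquality
  using (_≡_; refl; sym; trans; cong; cong₂; subst; subst₂)

IsCauchy : (ℕ → ℚ) → Set
IsCauchy x = ∀ ε → 0ℚ < ε → ∃[ N ] ∀ m n → N ℕ.≤ m → N ℕ.≤ n → ∣ x m - x n ∣ < ε

-- Real numbers as Cauchy sequences of rationals.  Two sequences may represent
-- the same real; the notions below depend only on the real represented.
record ℝ : Set where
  constructor mkℝ
  field
    seq    : ℕ → ℚ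
    cauchy : IsCauchy seq

open ℝ public

private
  ½ε+½ε : ∀ ε → ½ * ε + ½ * ε ≡ ε
  ½ε+½ε ε = trans (sym (*-distribʳ-+ ε ½ ½)) (*-identityˡ ε)

  0<½ε : ∀ {ε} → 0ℚ < ε → 0ℚ < ½ * ε
  0<½ε {ε} p = subst (_< ½ * ε) (*-zeroʳ ½) (*-monoʳ-<-pos ½ p)

  +-interchange : ∀ a b c d → (a + b) - (c + d) ≡ (a - c) + (b - d)
  +-interchange = solve 4 (λ a b c d → (a :+ b) :- (c :+ d) := (a :- c) :+ (b :- d)) refl
    where open +-*-Solver

  cauchy-+ : ∀ x y → IsCauchy x → IsCauchy y → IsCauchy (λ n → x n + y n)
  cauchy-+ x y cx cy ε 0<ε =
    let (M , hM) = cx (½ * ε) (0<½ε 0<ε)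
        (N , hN) = cy (½ * ε) (0<½ε 0<ε)
    in M ℕ.⊔ N , λ m n p q →
      subst₂ _<_ (cong ∣_∣ (sym (+-interchange (x m) (y m) (x n) (y n)))) (½ε+½ε ε)
        (≤-<-trans (∣p+q∣≤∣p∣+∣q∣ (x m - x n) (y m - y n))
          (+-mono-< (hM m n (ℕ.≤-trans (ℕ.m≤m⊔n M N) p) (ℕ.≤-trans (ℕ.m≤m⊔n M N) q))
                    (hN m n (ℕ.≤-trans (ℕ.m≤n⊔m M N) p) (ℕ.≤-trans (ℕ.m≤n⊔m M N) q))))

  neg-distance : ∀ a b → ∣ (- a) - (- b) ∣ ≡ ∣ a - b ∣
  neg-distance a b = trans (cong ∣_∣ (sym (neg-distrib-+ a (- b)))) (∣-p∣≡∣p∣ (a - b))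

  cauchy-neg : ∀ x → IsCauchy x → IsCauchy (λ n → - x n)
  cauchy-neg x cx ε 0<ε =
    let (N , h) = cx ε 0<ε
    in N , λ m n p q → subst (_< ε) (sym (neg-distance (x m) (x n))) (h m n p q)

  ∣a∣-∣b∣≤∣a-b∣ : ∀ a b → ∣ a ∣ - ∣ b ∣ ≤ ∣ a - b ∣
  ∣a∣-∣b∣≤∣a-b∣ a b = subst₂ _≤_ (cong (λ t → ∣ t ∣ - ∣ b ∣) (cancel a b)) (cancel′ ∣ a - b ∣ ∣ b ∣)
      (+-monoˡ-≤ (- ∣ b ∣) (∣p+q∣≤∣p∣+∣q∣ (a - b) b))
    where
    open +-*-Solver
    cancel : ∀ a b → (a - b) + b ≡ a
    cancel = solve 2 (λ a b → (a :- b) :+ b := a) refl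
    cancel′ : ∀ a b → (a + b) - b ≡ a
    cancel′ = solve 2 (λ a b → (a :+ b) :- b := a) refl

  neg-sub : ∀ a b → - (a - b) ≡ b - a
  neg-sub = solve 2 (λ a b → :- (a :- b) := b :- a) refl
    where open +-*-Solver

  distance-sym : ∀ a b → ∣ a - b ∣ ≡ ∣ b - a ∣
  distance-sym a b = trans (sym (∣-p∣≡∣p∣ (a - b))) (cong ∣_∣ (neg-sub a b))

  ∣∣a∣-∣b∣∣≤∣a-b∣ : ∀ a b → ∣ ∣ a ∣ - ∣ b ∣ ∣ ≤ ∣ a - b ∣
  ∣∣a∣-∣b∣∣≤∣a-b∣ a b = case ∣p∣≡p∨∣p∣≡-p (∣ a ∣ - ∣ b ∣) of λ where
    (inj₁ e) → subst (_≤ ∣ a - b ∣) (sym e) (∣a∣-∣b∣≤∣a-b∣ a b)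
    (inj₂ e) → subst₂ _≤_ (sym (trans e (neg-sub ∣ a ∣ ∣ b ∣))) (distance-sym b a)
                 (∣a∣-∣b∣≤∣a-b∣ b a)

  cauchy-abs : ∀ x → IsCauchy x → IsCauchy (λ n → ∣ x n ∣)
  cauchy-abs x cx ε 0<ε =
    let (N , h) = cx ε 0<ε
    in N , λ m n p q → ≤-<-trans (∣∣a∣-∣b∣∣≤∣a-b∣ (x m) (x n)) (h m n p q)

  cauchy-const : ∀ q → IsCauchy (λ _ → q)
  cauchy-const q ε 0<ε = 0 , λ _ _ _ _ → subst (_< ε) (sym (cong ∣_∣ (+-inverseʳ q))) 0<ε

  cauchy-scale : ∀ q x → IsCauchy x → IsCauchy (λ n → q * x n)
  cauchy-scale q x cx ε 0<ε = N , λ m n p r →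
      subst (_< ε) (sym (trans (cong ∣_∣ (factor q (x m) (x n))) (∣p*q∣≡∣p∣*∣q∣ q (x m - x n))))
        (≤-<-trans (*-monoʳ-≤-nonNeg ∣ x m - x n ∣ {{∣-∣-nonNeg (x m - x n)}} ∣q∣≤c)
          (subst (c * ∣ x m - x n ∣ <_) cδ≡ε (*-monoʳ-<-pos c (h m n p r))))
    where
    c = ∣ q ∣ + 1ℚ
    ∣q∣≤c : ∣ q ∣ ≤ c
    ∣q∣≤c = subst (_≤ c) (+-identityʳ ∣ q ∣) (+-monoʳ-≤ ∣ q ∣ (<⇒≤ (positive⁻¹ 1ℚ)))
    instance
      c>0 : Positive c
      c>0 = nonNeg+pos⇒pos ∣ q ∣ {{∣-∣-nonNeg q}} 1ℚ
      c≢0 = pos⇒nonZero c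
      1/c>0 = 1/pos⇒pos c
    δ = 1/ c * ε
    0<δ : 0ℚ < δ
    0<δ = subst (_< δ) (*-zeroʳ (1/ c)) (*-monoʳ-<-pos (1/ c) 0<ε)
    cδ≡ε : c * δ ≡ ε
    cδ≡ε = trans (sym (*-assoc c (1/ c) ε)) (trans (cong (_* ε) (*-inverseʳ c)) (*-identityˡ ε))
    N×h = cx δ 0<δ
    N = proj₁ N×h
    h = proj₂ N×h
    factor : ∀ q a b → q * a - q * b ≡ q * (a - b)
    factor = solve 3 (λ q a b → q :* a :- q :* b := q :* (a :- b)) refl
      where open +-*-Solver

infix  4 _<ᴿ_
infixl 6 _+ᴿ_ _-ᴿ_
infixr 7 _·_
infix  8 1/_^_

fromℚ : ℚ → ℝ
fromℚ q = mkℝ (λ _ → q) (cauchy-const q)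

_+ᴿ_ : ℝ → ℝ → ℝ
x +ᴿ y = mkℝ (λ n → seq x n + seq y n) (cauchy-+ (seq x) (seq y) (cauchy x) (cauchy y))

_-ᴿ_ : ℝ → ℝ → ℝ
x -ᴿ y = mkℝ (λ n → seq x n - seq y n) (cauchy-+ (seq x) (λ n → - seq y n) (cauchy x) (cauchy-neg (seq y) (cauchy y)))

_·_ : ℚ → ℝ → ℝ
q · x = mkℝ (λ n → q * seq x n) (cauchy-scale q (seq x) (cauchy x))

∣_∣ᴿ : ℝ → ℝ
∣ x ∣ᴿ = mkℝ (λ n → ∣ seq x n ∣) (cauchy-abs (seq x) (cauchy x))

_<ᴿ_ : ℝ → ℝ → Set
x <ᴿ y = ∃[ δ ] 0ℚ < δ × ∃[ N ] ∀ n → N ℕ.≤ n → seq x n + δ ≤ seq y n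

partialSum : (ℕ → ℝ) → ℕ → ℝ
partialSum a zero    = fromℚ 0ℚ
partialSum a (suc n) = partialSum a n +ᴿ a n

-- Rational ε suffice, since every positive real exceeds a positive rational.
_ConvergesTo_ : (ℕ → ℝ) → ℝ → Set
a ConvergesTo x = ∀ ε → 0ℚ < ε → ∃[ N ] ∀ n → N ℕ.≤ n → ∣ a n -ᴿ x ∣ᴿ <ᴿ fromℚ ε

-- ∑_{i ≥ 0} a i = s
HasSum : (ℕ → ℝ) → ℝ → Set
HasSum a s = partialSum a ConvergesTo s

-- ∑_{k ≥ 0} (∑_{i ≥ 0} a k i) = s, where every inner series is required to converge.
HasIteratedSum : (ℕ → ℕ → ℝ) → ℝ → Set
HasIteratedSum a s = ∃[ r ] (∀ k → HasSum (a k) (r k)) × HasSum r s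

1/ℕ : (n : ℕ) → .{{NonZero n}} → ℚ
1/ℕ n = + 1 / n

1/_^_ : (m n : ℕ) → .{{NonZero m}} → ℚ
1/ m ^ n = 1/ℕ (m ℕ.^ n) {{ℕ.m^n≢0 m n}}

summand : (k j : ℕ) → .{{NonZero k}} → .{{NonZero j}} → ℚ
summand k j = 1/ k ^ 2 * 1/ℕ (j ℕ.* 2 ℕ.^ j) {{ℕ.m*n≢0 j (2 ℕ.^ j) {{it}} {{ℕ.m^n≢0 2 j}}}}

-- zetaSum s N = ∑_{n=1}^{N} 1/n^s
zetaSum : ℕ → ℕ → ℚ
zetaSum s zero    = 0ℚ
zetaSum s (suc n) = zetaSum s n + 1/ (suc n) ^ s

private
  toℚᵘ-1/ℕ : ∀ n → toℚᵘ (1/ℕ (suc n)) ℚᵘ.≃ mkℚᵘ (+ 1) n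
  toℚᵘ-1/ℕ n = toℚᵘ-fromℚᵘ (mkℚᵘ (+ 1) n)

  ≤-via : ∀ {x y a b} → toℚᵘ x ℚᵘ.≃ a → toℚᵘ y ℚᵘ.≃ b → a ℚᵘ.≤ b → x ≤ y
  ≤-via x≃a y≃b a≤b =
    toℚᵘ-cancel-≤ (ℚᵘ.≤-respˡ-≃ (ℚᵘ.≃-sym x≃a) (ℚᵘ.≤-respʳ-≃ (ℚᵘ.≃-sym y≃b) a≤b))

  <-via : ∀ {x y a b} → toℚᵘ x ℚᵘ.≃ a → toℚᵘ y ℚᵘ.≃ b → a ℚᵘ.< b → x < y
  <-via x≃a y≃b a<b =
    toℚᵘ-cancel-< (ℚᵘ.<-respˡ-≃ (ℚᵘ.≃-sym x≃a) (ℚᵘ.<-respʳ-≃ (ℚᵘ.≃-sym y≃b) a<b))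

  +-via : ∀ {x y z a b c} → toℚᵘ x ℚᵘ.≃ a → toℚᵘ y ℚᵘ.≃ b → toℚᵘ z ℚᵘ.≃ c →
          a ℚᵘ.+ b ℚᵘ.≃ c → x + y ≡ z
  +-via {x} {y} x≃a y≃b z≃c e = toℚᵘ-injective
    (ℚᵘ.≃-trans (toℚᵘ-homo-+ x y) (ℚᵘ.≃-trans (ℚᵘ.+-cong x≃a y≃b) (ℚᵘ.≃-trans e (ℚᵘ.≃-sym z≃c))))

  1/ℕ-antimono : ∀ m n .{{_ : NonZero m}} .{{_ : NonZero n}} → m ℕ.≤ n → 1/ℕ n ≤ 1/ℕ m
  1/ℕ-antimono (suc m) (suc n) m≤n =
    ≤-via {1/ℕ (suc n)} {1/ℕ (suc m)} {mkℚᵘ (+ 1) n} {mkℚᵘ (+ 1) m} (toℚᵘ-1/ℕ n) (toℚᵘ-1/ℕ m)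
      (ℚᵘ.*≤* (ℤ.*-monoˡ-≤-nonNeg (+ 1) (+≤+ m≤n)))

  1/ℕ-pos : ∀ n .{{_ : NonZero n}} → 0ℚ < 1/ℕ n
  1/ℕ-pos n = positive⁻¹ _ {{normalize-pos 1 n}}

  1/ℕ-telescope : ∀ n → 1/ℕ (suc (suc n) ℕ.* suc n) + 1/ℕ (suc (suc n)) ≡ 1/ℕ (suc n)
  1/ℕ-telescope n =
    +-via {1/ℕ (m ℕ.* m′)} {1/ℕ m} {1/ℕ m′}
          {mkℚᵘ (+ 1) (n ℕ.+ suc n ℕ.* suc n)} {mkℚᵘ (+ 1) (suc n)} {mkℚᵘ (+ 1) n}
      (toℚᵘ-1/ℕ (n ℕ.+ suc n ℕ.* suc n)) (toℚᵘ-1/ℕ (suc n)) (toℚᵘ-1/ℕ n) (ℚᵘ.*≡* eq)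
    where
    m = suc (suc n)
    m′ = suc n
    ring : ∀ y → (+ 1 ℤ.* (+ 1 ℤ.+ y) ℤ.+ + 1 ℤ.* ((+ 1 ℤ.+ y) ℤ.* y)) ℤ.* y
               ≡ + 1 ℤ.* (((+ 1 ℤ.+ y) ℤ.* y) ℤ.* (+ 1 ℤ.+ y))
    ring = ℤ-Solver.solve-∀
    eq : (+ 1 ℤ.* + m ℤ.+ + 1 ℤ.* + (m ℕ.* m′)) ℤ.* + m′ ≡ + 1 ℤ.* + ((m ℕ.* m′) ℕ.* m)
    eq = trans (cong (λ t → (+ 1 ℤ.* + m ℤ.+ + 1 ℤ.* t) ℤ.* + m′) (ℤ.pos-* m m′))
      (trans (ring (+ m′))
        (cong (+ 1 ℤ.*_) (sym (trans (ℤ.pos-* (m ℕ.* m′) m) (cong (ℤ._* + m) (ℤ.pos-* m m′))))))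

  archimedean : ∀ ε → 0ℚ < ε → ∃[ N ] 1/ℕ (suc N) < ε
  archimedean ε@(mkℚ (+ suc p) q _) _ = suc q ,
    <-via {1/ℕ (suc (suc q))} {ε} {mkℚᵘ (+ 1) (suc q)} {mkℚᵘ (+ suc p) q}
      (toℚᵘ-1/ℕ (suc q)) ℚᵘ.≃-refl
      (ℚᵘ.*<* (+<+ (ℕ.≤-trans (ℕ.s≤s (ℕ.≤-reflexive (ℕ.+-identityʳ (suc q))))
                               (ℕ.m≤m+n (suc (suc q)) (p ℕ.* suc (suc q))))))
  archimedean (mkℚ (+ zero) _ _) (*<* (+<+ ()))
  archimedean (mkℚ (ℤ.-[1+ _ ]) _ _) (*<* ())

  module _ (s : ℕ) .{{_ : NonTrivial s}} where

    step : ∀ n → 1/ (suc (suc n)) ^ s + 1/ℕ (suc (suc n)) ≤ 1/ℕ (suc n)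
    step n = subst (1/ (suc (suc n)) ^ s + 1/ℕ m ≤_) (1/ℕ-telescope n)
      (+-monoˡ-≤ (1/ℕ m) (1/ℕ-antimono (m ℕ.* suc n) (m ℕ.^ s) {{_}} {{ℕ.m^n≢0 m s}} bound))
      where
      m = suc (suc n)
      bound : m ℕ.* suc n ℕ.≤ m ℕ.^ s
      bound = ℕ.≤-trans (ℕ.*-monoʳ-≤ m (ℕ.≤-trans (ℕ.n≤1+n (suc n))
                                          (ℕ.≤-reflexive (sym (ℕ.*-identityʳ m)))))
                (ℕ.^-monoʳ-≤ m (ℕ.nonTrivial⇒n>1 s))

    lower : ∀ m d → zetaSum s m ≤ zetaSum s (d ℕ.+ m)
    lower m zero    = ≤-refl
    lower m (suc d) = ≤-trans (lower m d)
      (subst (_≤ zetaSum s (suc d ℕ.+ m)) (+-identityʳ (zetaSum s (d ℕ.+ m)))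
        (+-monoʳ-≤ (zetaSum s (d ℕ.+ m)) (<⇒≤ (1/ℕ-pos (suc (d ℕ.+ m) ℕ.^ s) {{ℕ.m^n≢0 (suc (d ℕ.+ m)) s}}))))

    upper : ∀ m d → zetaSum s (d ℕ.+ suc m) + 1/ℕ (suc (d ℕ.+ m)) ≤ zetaSum s (suc m) + 1/ℕ (suc m)
    upper m zero    = ≤-refl
    upper m (suc d) rewrite ℕ.+-suc d m = ≤-trans
      (≤-trans (≤-reflexive (+-assoc (zetaSum s (suc (d ℕ.+ m))) _ _))
               (+-monoʳ-≤ (zetaSum s (suc (d ℕ.+ m))) (step (d ℕ.+ m))))
      (subst (λ t → zetaSum s t + 1/ℕ (suc (d ℕ.+ m)) ≤ zetaSum s (suc m) + 1/ℕ (suc m))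
             (ℕ.+-suc d m) (upper m d))

    gap : ∀ m d → ∣ zetaSum s (d ℕ.+ suc m) - zetaSum s (suc m) ∣ ≤ 1/ℕ (suc m)
    gap m d = subst (_≤ 1/ℕ (suc m)) (sym (0≤p⇒∣p∣≡p 0≤diff))
        (subst (b - a ≤_) (cancel a (1/ℕ (suc m)))
          (+-monoˡ-≤ (- a) (≤-trans b≤b+ (upper m d))))
      where
      a = zetaSum s (suc m)
      b = zetaSum s (d ℕ.+ suc m)
      0≤diff : 0ℚ ≤ b - a
      0≤diff = subst (_≤ b - a) (+-inverseʳ a) (+-monoˡ-≤ (- a) (lower (suc m) d))
      b≤b+ : b ≤ b + 1/ℕ (suc (d ℕ.+ m))
      b≤b+ = subst (_≤ b + 1/ℕ (suc (d ℕ.+ m))) (+-identityʳ b)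
               (+-monoʳ-≤ b (<⇒≤ (1/ℕ-pos (suc (d ℕ.+ m)))))
      cancel : ∀ a u → (a + u) - a ≡ u
      cancel = solve 2 (λ a u → (a :+ u) :- a := u) refl
        where open +-*-Solver

    gap′ : ∀ N m → suc N ℕ.≤ m → ∣ zetaSum s m - zetaSum s (suc N) ∣ ≤ 1/ℕ (suc N)
    gap′ N m p = subst (λ t → ∣ zetaSum s t - zetaSum s (suc N) ∣ ≤ 1/ℕ (suc N))
                   (ℕ.m∸n+n≡m p) (gap N (m ℕ.∸ suc N))

    cauchy-zetaSum : IsCauchy (zetaSum s)
    cauchy-zetaSum ε 0<ε =
      let (N , h) = archimedean (½ * ε) (0<½ε 0<ε)
          c = zetaSum s (suc N)
      in suc N , λ m n p q →
        subst (_< ε) (cong ∣_∣ (split (zetaSum s m) (zetaSum s n) c))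
          (≤-<-trans (∣p-q∣≤∣p∣+∣q∣ (zetaSum s m - c) (zetaSum s n - c))
            (subst (∣ zetaSum s m - c ∣ + ∣ zetaSum s n - c ∣ <_) (½ε+½ε ε)
              (+-mono-< (≤-<-trans (gap′ N m p) h) (≤-<-trans (gap′ N n q) h))))
      where
      split : ∀ a b c → (a - c) - (b - c) ≡ a - b
      split = solve 3 (λ a b c → (a :- c) :- (b :- c) := a :- b) refl
        where open +-*-Solver

-- The Riemann zeta function at the integers s > 1, where it is given by its Dirichlet series.
ζ : (s : ℕ) → .{{NonTrivial s}} → ℝ
ζ s = mkℝ (zetaSum s) (cauchy-zetaSum s)

{-# OPTIONS --safe #-}

-- Write H_k = ∑_{i ≤ k} 1/i.  Summing over k first, the left-hand side is ∑_j H_j^{(2)} / (j 2^j),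
-- which is the Euler transform of the alternating series A = ∑_k (-1)^{k-1} H_k / k².  Since
-- H_k / k² is completely monotone, the transformed partial sum of length N differs from the
-- K-th partial sum of A by at most 2^{-N} + 1/(K + 1).
--
-- A is evaluated with the double sums T(σ, ρ) = ∑ σ^a ρ^b / (a b (a + b)), σ, ρ = ±1.  Partial
-- fractions in a b give T(1, 1) and T(-1, -1) as sums of (±1)^n H_{n-1} / n², summation over b
-- gives T(1, 1) and T(-1, 1) as sums of (±1)^n H_n / n², and adding up all four choices of signs
-- leaves only even a and b, i.e. T(1, 1) / 2.  These relations force 4 A = (5/2) ζ(3).  On the
-- triangles a + b ≤ N they hold up to errors of order H_N / N.

module Submission where

open import Defs
open import Data.Nat as ℕ using (ℕ; zero; suc; NonZero)
import Data.Nat.Properties as ℕ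
open import Data.Integer as ℤ using (+_)
import Data.Integer.Properties as ℤ
open import Data.Product using (∃-syntax; _×_; _,_; proj₁; proj₂)
open import Data.Rational hiding (NonZero)
open import Data.Rational.Properties
open import Data.Rational.Solver using (module +-*-Solver)
open import Data.Rational.Unnormalised as ℚᵘ using (mkℚᵘ)
import Data.Rational.Unnormalised.Properties as ℚᵘ
open import Data.Sum using (_⊎_; inj₁; inj₂)
open import Function using (_∘_)
open import Relation.Binary.PropositionalEquality
open +-*-Solver

-- Natural numbers and their reciprocals in ℚ

ι : ℕ → ℚ
ι zero    = 0ℚ
ι (suc n) = 1ℚ + ι n

ι-+ : ∀ m n → ι (m ℕ.+ n) ≡ ι m + ι n
ι-+ zero    n = sym (+-identityˡ (ι n))
ι-+ (suc m) n = trans (cong (_+_ 1ℚ) (ι-+ m n)) (sym (+-assoc 1ℚ (ι m) (ι n)))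

ι-* : ∀ m n → ι (m ℕ.* n) ≡ ι m * ι n
ι-* zero    n = sym (*-zeroˡ (ι n))
ι-* (suc m) n = trans (ι-+ n (m ℕ.* n)) (trans (cong (_+_ (ι n)) (ι-* m n))
  (solve 2 (λ a b → b :+ a :* b := (con 1ℚ :+ a) :* b) refl (ι m) (ι n)))

toℚᵘ-ι : ∀ n → toℚᵘ (ι n) ℚᵘ.≃ mkℚᵘ (+ n) 0
toℚᵘ-ι zero    = ℚᵘ.≃-refl
toℚᵘ-ι (suc n) = ℚᵘ.≃-trans (toℚᵘ-homo-+ 1ℚ (ι n))
  (ℚᵘ.≃-trans (ℚᵘ.+-congʳ (toℚᵘ 1ℚ) (toℚᵘ-ι n))
    (ℚᵘ.*≡* (cong (λ t → (+ 1 ℤ.+ t) ℤ.* + 1) (ℤ.*-identityʳ (+ n)))))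

-- Checked on unnormalised representatives, where no gcd gets in the way; the identities for
-- reciprocals below are derived from it.
1/ℕ-inverse : ∀ n → 1/ℕ (suc n) * ι (suc n) ≡ 1ℚ
1/ℕ-inverse n = toℚᵘ-injective
  (ℚᵘ.≃-trans (toℚᵘ-homo-* (1/ℕ (suc n)) (ι (suc n)))
    (ℚᵘ.≃-trans (ℚᵘ.*-cong (toℚᵘ-fromℚᵘ (mkℚᵘ (+ 1) n)) (toℚᵘ-ι (suc n)))
      (ℚᵘ.*≡* (trans (ℤ.*-identityʳ (+ 1 ℤ.* + suc n))
        (cong (λ k → + 1 ℤ.* + k) (sym (ℕ.*-identityʳ (suc n))))))))

inverse-unique : ∀ {a b c} → a * c ≡ 1ℚ → b * c ≡ 1ℚ → a ≡ b
inverse-unique {a} {b} {c} p q = begin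
  a            ≡⟨ *-identityʳ a ⟨
  a * 1ℚ       ≡⟨ cong (a *_) q ⟨
  a * (b * c)  ≡⟨ solve 3 (λ a b c → a :* (b :* c) := (a :* c) :* b) refl a b c ⟩
  (a * c) * b  ≡⟨ cong (_* b) p ⟩
  1ℚ * b       ≡⟨ *-identityˡ b ⟩
  b            ∎
  where open ≡-Reasoning

1/ℕ-* : ∀ m n .{{_ : NonZero m}} .{{_ : NonZero n}} →
        1/ℕ (m ℕ.* n) {{ℕ.m*n≢0 m n}} ≡ 1/ℕ m * 1/ℕ n
1/ℕ-* (suc m) (suc n) = inverse-unique {c = ι (suc m ℕ.* suc n)} (1/ℕ-inverse (n ℕ.+ m ℕ.* suc n)) (begin
  a * b * ι (suc m ℕ.* suc n)          ≡⟨ cong (a * b *_) (ι-* (suc m) (suc n)) ⟩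
  a * b * (ι (suc m) * ι (suc n))      ≡⟨ solve 4 (λ a b x y → a :* b :* (x :* y) := (a :* x) :* (b :* y))
         refl a b (ι (suc m)) (ι (suc n)) ⟩
  (a * ι (suc m)) * (b * ι (suc n))    ≡⟨ cong₂ _*_ (1/ℕ-inverse m) (1/ℕ-inverse n) ⟩
  1ℚ                                   ∎)
  where
  open ≡-Reasoning
  a = 1/ℕ (suc m)
  b = 1/ℕ (suc n)

-- Order on ℚ

≤-from-diff : ∀ {a b} → 0ℚ ≤ b - a → a ≤ b
≤-from-diff {a} {b} p = subst₂ _≤_ (+-identityʳ a)
  (solve 2 (λ a b → a :+ (b :- a) := b) refl a b) (+-monoʳ-≤ a p)

diff-nonneg : ∀ {a b} → a ≤ b → 0ℚ ≤ b - a
diff-nonneg {a} {b} p = subst (_≤ b - a) (+-inverseʳ a) (+-monoˡ-≤ (- a) p)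

+-nonneg : ∀ {a b} → 0ℚ ≤ a → 0ℚ ≤ b → 0ℚ ≤ a + b
+-nonneg = +-mono-≤

*-nonneg : ∀ {a b} → 0ℚ ≤ a → 0ℚ ≤ b → 0ℚ ≤ a * b
*-nonneg {a} {b} p q = nonNegative⁻¹ (a * b)
  {{nonNeg*nonNeg⇒nonNeg a {{nonNegative p}} b {{nonNegative q}}}}

*-mono-≤-nonneg : ∀ {a b c d} → 0ℚ ≤ a → 0ℚ ≤ d → a ≤ b → c ≤ d → a * c ≤ b * d
*-mono-≤-nonneg {a} {b} {c} {d} 0≤a 0≤d a≤b c≤d = ≤-trans
  (*-monoˡ-≤-nonNeg a {{nonNegative 0≤a}} c≤d) (*-monoʳ-≤-nonNeg d {{nonNegative 0≤d}} a≤b)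

0≤1 : 0ℚ ≤ 1ℚ
0≤1 = nonNegative⁻¹ 1ℚ

ι-nonneg : ∀ n → 0ℚ ≤ ι n
ι-nonneg zero    = ≤-refl
ι-nonneg (suc n) = +-nonneg 0≤1 (ι-nonneg n)

-- The shift by one makes every index admissible, so no `NonZero` argument has to be carried along.
u : ℕ → ℚ
u n = 1/ℕ (suc n)

uι : ∀ n → u n * ι (suc n) ≡ 1ℚ
uι = 1/ℕ-inverse

u-pos : ∀ n → 0ℚ < u n
u-pos n = positive⁻¹ (u n) {{normalize-pos 1 (suc n)}}

u-nonneg : ∀ n → 0ℚ ≤ u n
u-nonneg n = <⇒≤ (u-pos n)

-- Partial fractions: for a = i + 1 and b = j + 1 the index `suc (i + j)` stands for the denominator
-- a + b.
u*u : ∀ i j → u i * u j ≡ u (suc (i ℕ.+ j)) * (u i + u j)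
u*u i j = begin
  a * b                             ≡⟨ *-identityˡ (a * b) ⟨
  1ℚ * (a * b)                      ≡⟨ cong (_* (a * b)) (uι (suc (i ℕ.+ j))) ⟨
  c * ι (suc (suc (i ℕ.+ j))) * (a * b)
    ≡⟨ cong (λ t → c * t * (a * b)) (trans (cong (_+_ 1ℚ ∘ _+_ 1ℚ) (ι-+ i j))
         (solve 2 (λ x y → con 1ℚ :+ (con 1ℚ :+ (x :+ y)) := (con 1ℚ :+ x) :+ (con 1ℚ :+ y))
                refl (ι i) (ι j))) ⟩
  c * (ι (suc i) + ι (suc j)) * (a * b)
    ≡⟨ solve 5 (λ a b c x y → c :* (x :+ y) :* (a :* b) := c :* ((a :* x) :* b :+ a :* (b :* y)))
           refl a b c (ι (suc i)) (ι (suc j)) ⟩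
  c * ((a * ι (suc i)) * b + a * (b * ι (suc j)))
    ≡⟨ cong₂ (λ p q → c * (p * b + a * q)) (uι i) (uι j) ⟩
  c * (1ℚ * b + a * 1ℚ)             ≡⟨ solve 3 (λ a b c → c :* (con 1ℚ :* b :+ a :* con 1ℚ) := c :* (a :+ b))
         refl a b c ⟩
  c * (a + b)                       ∎
  where
  open ≡-Reasoning
  a = u i
  b = u j
  c = u (suc (i ℕ.+ j))

u-step : ∀ n → u n ≡ u (suc n) * u n + u (suc n)
u-step n = begin
  u n                              ≡⟨ *-identityˡ (u n) ⟨
  u 0 * u n                        ≡⟨ u*u 0 n ⟩
  u (suc n) * (1ℚ + u n)           ≡⟨ solve 2 (λ a b → b :* (con 1ℚ :+ a) := b :* a :+ b)
         refl (u n) (u (suc n)) ⟩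
  u (suc n) * u n + u (suc n)      ∎
  where open ≡-Reasoning

u-suc≤ : ∀ n → u (suc n) ≤ u n
u-suc≤ n = ≤-from-diff (subst (0ℚ ≤_) (begin
  u (suc n) * u n                               ≡⟨ solve 2 (λ a b → b :* a := (b :* a :+ b) :- b)
         refl (u n) (u (suc n)) ⟩
  (u (suc n) * u n + u (suc n)) - u (suc n)     ≡⟨ cong (_- u (suc n)) (u-step n) ⟨
  u n - u (suc n)                               ∎) (*-nonneg (u-nonneg (suc n)) (u-nonneg n)))
  where open ≡-Reasoning

u≤1 : ∀ n → u n ≤ 1ℚ
u≤1 zero    = ≤-refl
u≤1 (suc n) = ≤-trans (u-suc≤ n) (u≤1 n)

u-antitone : ∀ d n → u (d ℕ.+ n) ≤ u n
u-antitone zero    n = ≤-refl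
u-antitone (suc d) n = ≤-trans (u-suc≤ (d ℕ.+ n)) (u-antitone d n)

-- Finite sums

Σ< : ℕ → (ℕ → ℚ) → ℚ
Σ< zero    f = 0ℚ
Σ< (suc n) f = Σ< n f + f n

Σ-cong : ∀ n {f g} → (∀ i → f i ≡ g i) → Σ< n f ≡ Σ< n g
Σ-cong zero    e = refl
Σ-cong (suc n) e = cong₂ _+_ (Σ-cong n e) (e n)

Σ-+ : ∀ n f g → Σ< n (λ i → f i + g i) ≡ Σ< n f + Σ< n g
Σ-+ zero    f g = refl
Σ-+ (suc n) f g = trans (cong (_+ (f n + g n)) (Σ-+ n f g))
  (solve 4 (λ a b c d → (a :+ b) :+ (c :+ d) := (a :+ c) :+ (b :+ d)) refl (Σ< n f) (Σ< n g) (f n) (g n))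

Σ-* : ∀ n c f → Σ< n (λ i → c * f i) ≡ c * Σ< n f
Σ-* zero    c f = sym (*-zeroʳ c)
Σ-* (suc n) c f = trans (cong (_+ c * f n) (Σ-* n c f)) (sym (*-distribˡ-+ c (Σ< n f) (f n)))

Σ-front : ∀ n f → Σ< (suc n) f ≡ f 0 + Σ< n (f ∘ suc)
Σ-front zero    f = trans (+-identityˡ (f 0)) (sym (+-identityʳ (f 0)))
Σ-front (suc n) f = trans (cong (_+ f (suc n)) (Σ-front n f)) (+-assoc (f 0) (Σ< n (f ∘ suc)) (f (suc n)))

Σ-nonneg : ∀ n {f} → (∀ i → 0ℚ ≤ f i) → 0ℚ ≤ Σ< n f
Σ-nonneg zero    p = ≤-refl
Σ-nonneg (suc n) p = +-nonneg (Σ-nonneg n p) (p n)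

H : ℕ → ℚ
H n = Σ< n u

s : ℕ → ℚ
s zero    = 1ℚ
s (suc n) = - s n

h : ℕ → ℚ
h zero    = 1ℚ
h (suc n) = ½ * h n

-- Completely monotone sequences and the Euler transform

-- An additive f is a difference table: f n k is the n-th difference, up to the sign (-1)ⁿ, of
-- f 0 at k.  The condition is symmetric in n and k, and a nonnegative table is a completely
-- monotone sequence.
Additive : (ℕ → ℕ → ℚ) → Set
Additive f = ∀ n k → f n k ≡ f (suc n) k + f n (suc k)

Nonneg₂ : (ℕ → ℕ → ℚ) → Set
Nonneg₂ f = ∀ n k → 0ℚ ≤ f n k

transpose : (ℕ → ℕ → ℚ) → ℕ → ℕ → ℚ
transpose f n k = f k n

transpose-additive : ∀ {f} → Additive f → Additive (transpose f)
transpose-additive {f} p n k = trans (p k n) (+-comm (f (suc k) n) (f k (suc n)))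

-- The table of k ↦ f 0 k / (k + 1).  The recursion is Leibniz' rule for differences applied to
-- f 0 k = (k + 1) · L f 0 k, and shows that dividing by k + 1 preserves complete monotonicity.
L : (ℕ → ℕ → ℚ) → ℕ → ℕ → ℚ
L f zero    k = u k * f 0 k
L f (suc n) k = u (suc n ℕ.+ k) * (f (suc n) k + ι (suc n) * L f n k)

ι*u* : ∀ m a → ι (suc m) * (u m * a) ≡ a
ι*u* m a = trans (solve 3 (λ i v a → i :* (v :* a) := (v :* i) :* a) refl (ι (suc m)) (u m) a)
  (trans (cong (_* a) (uι m)) (*-identityˡ a))

-- Adding x to both sides turns the factor m + 1 into m + 2, which moves an entry of `L` to the next
-- denominator.
u-next : ∀ m {x a} → ι (suc m) * x ≡ a → x ≡ u (suc m) * (a + x)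
u-next m {x} {a} e = sym (begin
  u (suc m) * (a + x)                ≡⟨ cong (λ t → u (suc m) * (t + x)) e ⟨
  u (suc m) * (ι (suc m) * x + x)    ≡⟨ solve 3 (λ v i x → v :* (i :* x :+ x) := (v :* (con 1ℚ :+ i)) :* x)
         refl (u (suc m)) (ι (suc m)) x ⟩
  u (suc m) * ι (suc (suc m)) * x    ≡⟨ cong (_* x) (uι (suc m)) ⟩
  1ℚ * x                             ≡⟨ *-identityˡ x ⟩
  x                                  ∎)
  where open ≡-Reasoning

-- `u-next` puts the entry over the denominator of its two neighbours; additivity of `f` and the
-- induction hypothesis then split the numerator into theirs.
L-additive : ∀ {f} → Additive f → Additive (L f)
L-additive {f} p zero k = begin
  x                                  ≡⟨ u-next k (ι*u* k (f 0 k)) ⟩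
  c * (f 0 k + x)                    ≡⟨ cong (λ t → c * (t + x)) (p 0 k) ⟩
  c * (f 1 k + f 0 (suc k) + x)      ≡⟨ solve 4 (λ c a b x → c :* (a :+ b :+ x) := c :* (a :+ (con 1ℚ) :* x) :+ c :* b)
         refl c (f 1 k) (f 0 (suc k)) x ⟩
  L f 1 k + L f 0 (suc k)            ∎
  where
  open ≡-Reasoning
  x = L f 0 k
  c = u (suc k)
L-additive {f} p (suc n) k = begin
  x                                  ≡⟨ u-next (suc n ℕ.+ k) (ι*u* (suc n ℕ.+ k) (f (suc n) k + i * L f n k)) ⟩
  c * (f (suc n) k + i * L f n k + x)
    ≡⟨ cong₂ (λ t v → c * (t + i * v + x)) (p (suc n) k) (L-additive p n k) ⟩
  c * ((a + b) + i * (x + y) + x)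
    ≡⟨ solve 6 (λ c a b i x y → c :* ((a :+ b) :+ i :* (x :+ y) :+ x) := c :* (a :+ (con 1ℚ :+ i) :* x) :+ c :* (b :+ i :* y))
           refl c a b i x y ⟩
  c * (a + ι (suc (suc n)) * x) + c * (b + i * y)
    ≡⟨ cong (λ m → L f (suc (suc n)) k + u (suc m) * (b + i * y)) (ℕ.+-suc n k) ⟨
  L f (suc (suc n)) k + L f (suc n) (suc k) ∎
  where
  open ≡-Reasoning
  x = L f (suc n) k
  y = L f n (suc k)
  a = f (suc (suc n)) k
  b = f (suc n) (suc k)
  i = ι (suc n)
  c = u (suc (suc n) ℕ.+ k)

L-nonneg : ∀ {f} → Nonneg₂ f → Nonneg₂ (L f)
L-nonneg p zero    k = *-nonneg (u-nonneg k) (p 0 k)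
L-nonneg p (suc n) k = *-nonneg (u-nonneg (suc n ℕ.+ k))
  (+-nonneg (p (suc n) k) (*-nonneg (ι-nonneg (suc n)) (L-nonneg p n k)))

-- At k = 0 the recursion adds `f n 0` to n times the previous entry to get n + 1 times the new one,
-- so `L` averages the first column.
L-column : ∀ f n → L f n 0 ≡ u n * Σ< (suc n) (λ i → f i 0)
L-column f zero    = cong (u 0 *_) (sym (+-identityˡ (f 0 0)))
L-column f (suc n) = cong₂ (λ m t → u (suc m) * t) (ℕ.+-identityʳ n) (begin
  f (suc n) 0 + ι (suc n) * L f n 0        ≡⟨ cong (λ t → f (suc n) 0 + ι (suc n) * t) (L-column f n) ⟩
  f (suc n) 0 + ι (suc n) * (u n * S)      ≡⟨ cong (λ t → f (suc n) 0 + t) (ι*u* n S) ⟩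
  f (suc n) 0 + S                          ≡⟨ +-comm (f (suc n) 0) S ⟩
  S + f (suc n) 0                          ∎)
  where
  open ≡-Reasoning
  S = Σ< (suc n) (λ i → f i 0)

-- The difference table of the constant sequence 1, from which the others are built.
δ₀ : ℕ → ℕ → ℚ
δ₀ zero    k = 1ℚ
δ₀ (suc n) k = 0ℚ

δ₀-additive : Additive δ₀
δ₀-additive zero    k = refl
δ₀-additive (suc n) k = refl

δ₀-nonneg : Nonneg₂ δ₀
δ₀-nonneg zero    k = 0≤1
δ₀-nonneg (suc n) k = ≤-refl

Σ-δ₀ : ∀ n → Σ< (suc n) (λ i → δ₀ i 0) ≡ 1ℚ
Σ-δ₀ zero    = refl
Σ-δ₀ (suc n) = trans (+-identityʳ _) (Σ-δ₀ n)

-- L δ₀ is the table of 1/(k + 1) and L (L δ₀) that of 1/(k + 1)², whose transpose starts with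
-- the row H (k + 1)/(k + 1); hence D is the table of H (k + 1)/(k + 1)².
D : ℕ → ℕ → ℚ
D = L (transpose (L (L δ₀)))

D-additive : Additive D
D-additive = L-additive (transpose-additive (L-additive (L-additive δ₀-additive)))

D-nonneg : Nonneg₂ D
D-nonneg = L-nonneg (λ n k → L-nonneg (L-nonneg δ₀-nonneg) k n)

-- The harmonic numbers of order two.
G : ℕ → ℚ
G n = Σ< n (λ i → u i * u i)

D-row : ∀ k → D 0 k ≡ u k * (u k * H (suc k))
D-row k = cong (u k *_) (trans (L-column (L δ₀) k)
  (cong (u k *_) (Σ-cong (suc k) λ i → trans (L-column δ₀ i)
    (trans (cong (u i *_) (Σ-δ₀ i)) (*-identityʳ (u i))))))

-- The first column of the transposed table is the row of squares 1/(i + 1)^2. Thus the differences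
-- of H_k / k^2 at the start yield the second-order harmonic numbers of the double series.
D-column : ∀ n → D n 0 ≡ u n * G (suc n)
D-column n = trans (L-column _ n)
  (cong (u n *_) (Σ-cong (suc n) λ i → cong (u i *_) (*-identityʳ (u i))))

module _ {f : ℕ → ℕ → ℚ} (add : Additive f) (nn : Nonneg₂ f) where

  row-suc≤ : ∀ n k → f n (suc k) ≤ f n k
  row-suc≤ n k = ≤-from-diff (subst (0ℚ ≤_)
    (trans (solve 2 (λ a b → a := (a :+ b) :- b) refl (f (suc n) k) (f n (suc k)))
           (cong (_- f n (suc k)) (sym (add n k)))) (nn (suc n) k))

  column-suc≤ : ∀ n k → f (suc n) k ≤ f n k
  column-suc≤ n k = ≤-from-diff (subst (0ℚ ≤_)
    (trans (solve 2 (λ a b → b := (a :+ b) :- a) refl (f (suc n) k) (f n (suc k)))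
           (cong (_- f (suc n) k) (sym (add n k)))) (nn n (suc k)))

  column≤ : ∀ n k → f n k ≤ f 0 k
  column≤ zero    k = ≤-refl
  column≤ (suc n) k = ≤-trans (column-suc≤ n k) (column≤ n k)

-- Alternating sums

alternating : (ℕ → ℚ) → ℕ → ℚ
alternating a K = Σ< K (λ k → s k * a k)

alternating-front : ∀ a K → alternating a (suc K) ≡ a 0 - alternating (a ∘ suc) K
alternating-front a K = trans (Σ-front K (λ k → s k * a k)) (cong₂ _+_ (*-identityˡ (a 0)) (begin
  Σ< K (λ k → - s k * a (suc k))         ≡⟨ Σ-cong K (λ k → solve 2 (λ s a → (:- s) :* a := (:- con 1ℚ) :* (s :* a))
         refl (s k) (a (suc k))) ⟩
  Σ< K (λ k → - 1ℚ * (s k * a (suc k)))  ≡⟨ Σ-* K (- 1ℚ) (λ k → s k * a (suc k)) ⟩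
  - 1ℚ * alternating (a ∘ suc) K         ≡⟨ solve 1 (λ x → (:- con 1ℚ) :* x := :- x)
         refl (alternating (a ∘ suc) K) ⟩
  - alternating (a ∘ suc) K              ∎))
  where open ≡-Reasoning

-- Leibniz's argument: after the first term, what is subtracted lies between 0 and `a 1`, hence
-- between 0 and `a 0`.
alternating-bounds : ∀ {a : ℕ → ℚ} → (∀ k → 0ℚ ≤ a k) → (∀ k → a (suc k) ≤ a k) →
                     ∀ K → 0ℚ ≤ alternating a K × alternating a K ≤ a 0
alternating-bounds {a} nn dec zero    = ≤-refl , nn 0
alternating-bounds {a} nn dec (suc K) =
  let (lo , hi) = alternating-bounds {a ∘ suc} (nn ∘ suc) (dec ∘ suc) K
  in subst (λ x → 0ℚ ≤ x × x ≤ a 0) (sym (alternating-front a K))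
       ( diff-nonneg (≤-trans hi (dec 0))
       , ≤-from-diff (subst (0ℚ ≤_) (solve 2 (λ x r → r := x :- (x :- r))
              refl (a 0) (alternating (a ∘ suc) K)) lo))

-- Each value `a (suc k)` occurs with the signs `s k` and `s (suc k)`, so only the two ends survive.
alternating-shift : ∀ a K → alternating a K + alternating (a ∘ suc) K ≡ a 0 - s K * a K
alternating-shift a zero    = solve 1 (λ x → con 0ℚ := x :- con 1ℚ :* x) refl (a 0)
alternating-shift a (suc K) = begin
  (A + s K * a K) + (B + s K * a (suc K))
    ≡⟨ solve 5 (λ x y s p q → (x :+ s :* p) :+ (y :+ s :* q) := (x :+ y) :+ s :* p :+ s :* q)
           refl A B (s K) (a K) (a (suc K)) ⟩
  (A + B) + s K * a K + s K * a (suc K)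
    ≡⟨ cong (λ t → t + s K * a K + s K * a (suc K)) (alternating-shift a K) ⟩
  (a 0 - s K * a K) + s K * a K + s K * a (suc K)
    ≡⟨ solve 4 (λ x s p q → (x :- s :* p) :+ s :* p :+ s :* q := x :- (:- s) :* q)
           refl (a 0) (s K) (a K) (a (suc K)) ⟩
  a 0 - - s K * a (suc K) ∎
  where
  open ≡-Reasoning
  A = alternating a K
  B = alternating (a ∘ suc) K

h-nonneg : ∀ n → 0ℚ ≤ h n
h-nonneg zero    = 0≤1
h-nonneg (suc n) = *-nonneg (nonNegative⁻¹ ½) (h-nonneg n)

∣s∣≡1 : ∀ n → ∣ s n ∣ ≡ 1ℚ
∣s∣≡1 zero    = refl
∣s∣≡1 (suc n) = trans (∣-p∣≡∣p∣ (s n)) (∣s∣≡1 n)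

-- The weights 1/2, 1/4, ... together with the leftover `h N` add up to 1; keeping the leftover lets
-- the induction close.
geometric≤ : ∀ {g : ℕ → ℚ} {c} → (∀ n → g n ≤ c) → ∀ N → Σ< N (λ n → h (suc n) * g n) + h N * c ≤ c
geometric≤ {g} {c} p zero    = ≤-reflexive (solve 1 (λ c → con 0ℚ :+ con 1ℚ :* c := c) refl c)
geometric≤ {g} {c} p (suc N) = ≤-trans
  (+-monoˡ-≤ (h (suc N) * c) (+-monoʳ-≤ S (*-monoˡ-≤-nonNeg (h (suc N)) {{nonNegative (h-nonneg (suc N))}} (p N))))
  (subst (_≤ c) (solve 3 (λ S h c → S :+ h :* c := S :+ con ½ :* h :* c :+ con ½ :* h :* c)
         refl S (h N) c)
    (geometric≤ {g} p N))
  where S = Σ< N (λ n → h (suc n) * g n)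

module _ {f : ℕ → ℕ → ℚ} (add : Additive f) (nn : Nonneg₂ f) where

  alternating-add : ∀ n K → alternating (f n) K ≡ alternating (f (suc n)) K + alternating (f n ∘ suc) K
  alternating-add n K = trans
    (Σ-cong K (λ k → trans (cong (s k *_) (add n k)) (*-distribˡ-+ (s k) (f (suc n) k) (f n (suc k)))))
    (Σ-+ K (λ k → s k * f (suc n) k) (λ k → s k * f n (suc k)))

  -- Each step trades the alternating sum of row N for half that of row N + 1. The boundary terms at
  -- 0 form the transformed series, those at K the truncation error.
  euler-exact : ∀ N K → alternating (f 0) K ≡
    (Σ< N (λ n → h (suc n) * f n 0) + h N * alternating (f N) K) - s K * Σ< N (λ n → h (suc n) * f n K)
  euler-exact zero    K = solve 2 (λ R s → R := (con 0ℚ :+ con 1ℚ :* R) :- s :* con 0ℚ)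
         refl (alternating (f 0) K) (s K)
  euler-exact (suc N) K = begin
    alternating (f 0) K           ≡⟨ euler-exact N K ⟩
    (S + h N * R) - s K * T       ≡⟨ cong (λ t → (S + h N * t) - s K * T) R≡ ⟩
    (S + h N * (½ * (R′ + (f N 0 - s K * f N K)))) - s K * T
      ≡⟨ solve 7 (λ S h R a s b T → (S :+ h :* (con ½ :* (R :+ (a :- s :* b)))) :- s :* T :=
           ((S :+ con ½ :* h :* a) :+ con ½ :* h :* R) :- s :* (T :+ con ½ :* h :* b))
           refl S (h N) R′ (f N 0) (s K) (f N K) T ⟩
    ((S + h (suc N) * f N 0) + h (suc N) * R′) - s K * (T + h (suc N) * f N K) ∎
    where
    open ≡-Reasoning
    S = Σ< N (λ n → h (suc n) * f n 0)
    T = Σ< N (λ n → h (suc n) * f n K)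
    R = alternating (f N) K
    R′ = alternating (f (suc N)) K
    R″ = alternating (f N ∘ suc) K
    -- One of two copies of `R` is split by additivity; its shifted part telescopes against the
    -- other copy.
    R≡ : R ≡ ½ * (R′ + (f N 0 - s K * f N K))
    R≡ = begin
      R                                     ≡⟨ solve 1 (λ r → r := con ½ :* (r :+ r)) refl R ⟩
      ½ * (R + R)                           ≡⟨ cong (λ t → ½ * (t + R)) (alternating-add N K) ⟩
      ½ * ((R′ + R″) + R)                   ≡⟨ solve 3 (λ a b c → con ½ :* ((a :+ b) :+ c) := con ½ :* (a :+ (c :+ b)))
             refl R′ R″ R ⟩
      ½ * (R′ + (R + R″))                   ≡⟨ cong (λ t → ½ * (R′ + t)) (alternating-shift (f N) K) ⟩
      ½ * (R′ + (f N 0 - s K * f N K))      ∎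

  -- The leftover row sum is at most its first entry, hence at most 1; the terms at K have total
  -- weight below 1 and entries at most `f 0 K`.
  euler-bound : f 0 0 ≤ 1ℚ → ∀ N K →
    ∣ Σ< N (λ n → h (suc n) * f n 0) - alternating (f 0) K ∣ ≤ h N + f 0 K
  euler-bound f≤1 N K = subst (_≤ h N + f 0 K) (cong ∣_∣ (begin
      s K * T - h N * R                          ≡⟨ solve 4 (λ S s T x → s :* T :- x := S :- ((S :+ x) :- s :* T))
             refl S (s K) T (h N * R) ⟩
      S - ((S + h N * R) - s K * T)              ≡⟨ cong (λ t → S - t) (euler-exact N K) ⟨
      S - alternating (f 0) K                    ∎))
    (≤-trans (∣p-q∣≤∣p∣+∣q∣ (s K * T) (h N * R))
      (≤-trans (≤-reflexive (+-comm ∣ s K * T ∣ ∣ h N * R ∣)) (+-mono-≤ hR≤ sT≤)))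
    where
    open ≡-Reasoning
    S = Σ< N (λ n → h (suc n) * f n 0)
    T = Σ< N (λ n → h (suc n) * f n K)
    R = alternating (f N) K
    bounds = alternating-bounds (nn N) (row-suc≤ add nn N) K
    hR≤ : ∣ h N * R ∣ ≤ h N
    hR≤ = subst₂ _≤_ (sym (0≤p⇒∣p∣≡p (*-nonneg (h-nonneg N) (proj₁ bounds)))) (*-identityʳ (h N))
      (*-monoˡ-≤-nonNeg (h N) {{nonNegative (h-nonneg N)}}
        (≤-trans (proj₂ bounds) (≤-trans (column≤ add nn N 0) f≤1)))
    0≤T : 0ℚ ≤ T
    0≤T = Σ-nonneg N (λ n → *-nonneg (h-nonneg (suc n)) (nn n K))
    sT≤ : ∣ s K * T ∣ ≤ f 0 K
    sT≤ = subst (_≤ f 0 K)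
      (sym (trans (∣p*q∣≡∣p∣*∣q∣ (s K) T) (trans (cong₂ _*_ (∣s∣≡1 K) (0≤p⇒∣p∣≡p 0≤T)) (*-identityˡ T))))
      (≤-trans (≤-from-diff (subst (0ℚ ≤_) (solve 2 (λ T x → x := (T :+ x) :- T) refl T (h N * f 0 K))
                 (*-nonneg (h-nonneg N) (nn 0 K))))
        (geometric≤ {λ n → f n K} (λ n → column≤ add nn n K) N))

-- Double sums over triangles

-- The sum over the antidiagonal i + j = n; shifting the rows of `F` avoids the subtraction n - i.
ad : (ℕ → ℕ → ℚ) → ℕ → ℚ
ad F zero    = F 0 0
ad F (suc n) = F 0 (suc n) + ad (λ i j → F (suc i) j) n

ad-cong : ∀ {F F′} n → (∀ i j → i ℕ.+ j ≡ n → F i j ≡ F′ i j) → ad F n ≡ ad F′ n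
ad-cong zero    p = p 0 0 refl
ad-cong (suc n) p = cong₂ _+_ (p 0 (suc n) refl) (ad-cong n (λ i j q → p (suc i) j (cong suc q)))

ad-+ : ∀ F F′ n → ad (λ i j → F i j + F′ i j) n ≡ ad F n + ad F′ n
ad-+ F F′ zero    = refl
ad-+ F F′ (suc n) = trans (cong (λ t → F 0 (suc n) + F′ 0 (suc n) + t) (ad-+ (λ i j → F (suc i) j) (λ i j → F′ (suc i) j) n))
  (solve 4 (λ a b c d → (a :+ b) :+ (c :+ d) := (a :+ c) :+ (b :+ d)) refl
    (F 0 (suc n)) (F′ 0 (suc n)) (ad (λ i j → F (suc i) j) n) (ad (λ i j → F′ (suc i) j) n))

ad-* : ∀ c F n → ad (λ i j → c * F i j) n ≡ c * ad F n
ad-* c F zero    = refl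
ad-* c F (suc n) = trans (cong (λ t → c * F 0 (suc n) + t) (ad-* c (λ i j → F (suc i) j) n))
  (sym (*-distribˡ-+ c (F 0 (suc n)) (ad (λ i j → F (suc i) j) n)))

ad-back : ∀ F n → ad F (suc n) ≡ ad (λ i j → F i (suc j)) n + F (suc n) 0
ad-back F zero    = refl
ad-back F (suc n) = trans (cong (λ t → F 0 (suc (suc n)) + t) (ad-back (λ i j → F (suc i) j) n))
  (sym (+-assoc (F 0 (suc (suc n))) (ad (λ i j → F (suc i) (suc j)) n) (F (suc (suc n)) 0)))

ad-transpose : ∀ F n → ad (transpose F) n ≡ ad F n
ad-transpose F zero    = refl
ad-transpose F (suc n) = trans (cong (λ t → F (suc n) 0 + t) (ad-transpose (λ i j → F i (suc j)) n))
  (trans (+-comm (F (suc n) 0) (ad (λ i j → F i (suc j)) n)) (sym (ad-back F n)))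

ad-fst : ∀ f n → ad (λ i j → f i) n ≡ Σ< (suc n) f
ad-fst f zero    = sym (+-identityˡ (f 0))
ad-fst f (suc n) = trans (ad-back (λ i j → f i) n) (cong (_+ f (suc n)) (ad-fst f n))

∣ad∣≤ : ∀ {F F′} → (∀ i j → ∣ F i j ∣ ≤ F′ i j) → ∀ n → ∣ ad F n ∣ ≤ ad F′ n
∣ad∣≤ p zero    = p 0 0
∣ad∣≤ {F} p (suc n) = ≤-trans (∣p+q∣≤∣p∣+∣q∣ (F 0 (suc n)) (ad (λ i j → F (suc i) j) n))
  (+-mono-≤ (p 0 (suc n)) (∣ad∣≤ (λ i j → p (suc i) j) n))

double : ℕ → ℕ
double zero    = zero
double (suc n) = suc (suc (double n))

-- Of two indices with an odd sum one is even.
ad-odd : ∀ F → (∀ a j → F (double a) j ≡ 0ℚ) → (∀ i b → F i (double b) ≡ 0ℚ) →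
          ∀ K → ad F (suc (double K)) ≡ 0ℚ
ad-odd F p q zero    = cong₂ _+_ (p 0 1) (q 1 0)
ad-odd F p q (suc K) = cong₂ _+_ (p 0 (suc (double (suc K)))) (cong₂ _+_ (q 1 (suc K))
  (ad-odd (λ i → F (suc (suc i))) (λ a → p (suc a)) (λ i → q (suc (suc i))) K))

-- Only pairs of odd indices survive, and 2a + 1 and 2b + 1 add up to 2(K + 1) exactly when a + b =
-- K.
ad-even : ∀ F → (∀ a j → F (double a) j ≡ 0ℚ) → (∀ i b → F i (double b) ≡ 0ℚ) →
          ∀ K → ad F (double (suc K)) ≡ ad (λ a b → F (suc (double a)) (suc (double b))) K
ad-even F p q zero    = trans (cong₂ (λ x y → x + (F 1 1 + y)) (p 0 2) (q 2 0))
  (solve 1 (λ x → con 0ℚ :+ (x :+ con 0ℚ) := x) refl (F 1 1))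
ad-even F p q (suc K) = trans
  (cong₂ (λ x y → x + (F 1 (suc (double (suc K))) + y)) (p 0 (double (suc (suc K))))
    (ad-even (λ i → F (suc (suc i))) (λ a → p (suc a)) (λ i → q (suc (suc i))) K))
  (+-identityˡ (F 1 (suc (double (suc K))) + ad (λ a b → F (suc (double (suc a))) (suc (double b))) K))

-- Convolutions of reciprocals and the sums T

conv : (ℕ → ℚ) → (ℕ → ℚ) → ℕ → ℚ
conv f g = ad (λ i j → f i * g j)

conv-comm : ∀ f g n → conv f g n ≡ conv g f n
conv-comm f g n = trans (ad-cong n (λ i j _ → *-comm (f i) (g j))) (ad-transpose (λ i j → g i * f j) n)

-- Partial fractions pull the common factor 1/(n + 2) out of the antidiagonal and leave two copies
-- of a harmonic sum.
conv-uu : ∀ n → conv u u n ≡ u (suc n) * (H (suc n) + H (suc n))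
conv-uu n = begin
  conv u u n                                  ≡⟨ ad-cong n (λ i j e → trans (u*u i j) (cong (λ m → u (suc m) * (u i + u j)) e)) ⟩
  ad (λ i j → u (suc n) * (u i + u j)) n      ≡⟨ ad-* (u (suc n)) (λ i j → u i + u j) n ⟩
  u (suc n) * ad (λ i j → u i + u j) n        ≡⟨ cong (u (suc n) *_) (ad-+ (λ i j → u i) (λ i j → u j) n) ⟩
  u (suc n) * (ad (λ i j → u i) n + ad (λ i j → u j) n)
    ≡⟨ cong (u (suc n) *_) (cong₂ _+_ (ad-fst u n) (trans (ad-transpose (λ i j → u i) n) (ad-fst u n))) ⟩
  u (suc n) * (H (suc n) + H (suc n))         ∎
  where open ≡-Reasoning

-- For a = n + 1 this is -(-1)^a / a, so `τ v u` approximates -T(-1, 1), while `τ v v` approximates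
-- T(-1, -1).
v : ℕ → ℚ
v n = s n * u n

s-+ : ∀ i j → s (i ℕ.+ j) ≡ s i * s j
s-+ zero    j = sym (*-identityˡ (s j))
s-+ (suc i) j = trans (cong -_ (s-+ i j)) (neg-distribˡ-* (s i) (s j))

conv-vv : ∀ n → conv v v n ≡ s n * conv u u n
conv-vv n = trans (ad-cong n λ i j e → begin
    s i * u i * (s j * u j)     ≡⟨ solve 4 (λ s u s′ u′ → s :* u :* (s′ :* u′) := s :* s′ :* (u :* u′))
           refl (s i) (u i) (s j) (u j) ⟩
    s i * s j * (u i * u j)     ≡⟨ cong (_* (u i * u j)) (trans (sym (s-+ i j)) (cong s e)) ⟩
    s n * (u i * u j)           ∎)
  (ad-* (s n) (λ i j → u i * u j) n)
  where open ≡-Reasoning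

-- τ f g N is the sum of f_{a-1} g_{b-1} / (a + b) over a, b ≥ 1 with a + b ≤ N + 1.
τ : (ℕ → ℚ) → (ℕ → ℚ) → ℕ → ℚ
τ f g N = Σ< N (λ n → u (suc n) * conv f g n)

-- Z N is zetaSum 3 N and W N = - ∑_{n=1}^{N} (-1)ⁿ/n³; X and Y are the harmonic sums with H_{n-1}.
X Y Z W : ℕ → ℚ
X N = Σ< N (λ n → u n * (u n * H n))
Y N = Σ< N (λ n → s n * (u n * (u n * H n)))
Z N = Σ< N (λ n → u n * (u n * u n))
W N = Σ< N (λ n → s n * (u n * (u n * u n)))

-- By `conv-uu` every term is twice the next term of `X`; the shift costs nothing because `X` starts
-- with a zero term.
τ-uu : ∀ N → τ u u N ≡ X (suc N) + X (suc N)
τ-uu zero    = refl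
τ-uu (suc N) = trans (cong₂ (λ a b → a + u (suc N) * b) (τ-uu N) (conv-uu N))
  (solve 3 (λ x a b → (x :+ x) :+ a :* (a :* (b :+ b)) := (x :+ a :* (a :* b)) :+ (x :+ a :* (a :* b))) refl
    (X (suc N)) (u (suc N)) (H (suc N)))

-- Antidiagonal n carries the sign `s n`, opposite to the sign `s (suc n)` of the matching term of
-- `Y`.
τ-vv : ∀ N → τ v v N ≡ - (Y (suc N) + Y (suc N))
τ-vv zero    = refl
τ-vv (suc N) = trans (cong₂ (λ a b → a + u (suc N) * b) (τ-vv N) (trans (conv-vv N) (cong (s N *_) (conv-uu N))))
  (solve 4 (λ y a b s → (:- (y :+ y)) :+ a :* (s :* (a :* (b :+ b))) :=
       :- ((y :+ (:- s) :* (a :* (a :* b))) :+ (y :+ (:- s) :* (a :* (a :* b))))) refl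
    (Y (suc N)) (u (suc N)) (H (suc N)) (s N))

-- For each a the sum ∑_b 1/(b (a + b)) equals H_a / a; cutting it off at a + b ≤ N + 1 loses
-- (H_{N+1} - H_{N+1-a}) / a, and E f N is the total loss, weighted by f_{a-1}.
E : (ℕ → ℚ) → ℕ → ℚ
E f = ad (λ i j → f i * (u i * (H (suc (i ℕ.+ j)) - H j)))

-- From N to N + 1 the new point with j = 0 contributes the next term of the harmonic sum; by
-- partial fractions the other losses shrink by exactly the new term of `τ`.
E-exact : ∀ f N → E f N ≡ Σ< (suc N) (λ n → f n * (u n * H (suc n))) - τ f u N
E-exact f zero    = solve 3 (λ f u h → f :* (u :* (h :- con 0ℚ)) := (con 0ℚ :+ f :* (u :* h)) :- con 0ℚ)
       refl (f 0) (u 0) (H 1)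
E-exact f (suc N) = begin
  E f (suc N)
    ≡⟨ ad-back (λ i j → f i * (u i * (H (suc (i ℕ.+ j)) - H j))) N ⟩
  ad (λ i j → f i * (u i * (H (suc (i ℕ.+ suc j)) - H (suc j)))) N + f (suc N) * (u (suc N) * (H (suc (suc (N ℕ.+ 0))) - 0ℚ))
    ≡⟨ cong₂ _+_ (ad-cong N pointwise) (cong (λ m → f (suc N) * (u (suc N) * (H (suc (suc m)) - 0ℚ))) (ℕ.+-identityʳ N)) ⟩
  ad (λ i j → f i * (u i * (H (suc (i ℕ.+ j)) - H j)) + (- c) * (f i * u j)) N + f (suc N) * (c * (H (suc (suc N)) - 0ℚ))
    ≡⟨ cong (_+ f (suc N) * (c * (H (suc (suc N)) - 0ℚ))) (trans (ad-+ _ _ N) (cong (_+_ (E f N)) (ad-* (- c) (λ i j → f i * u j) N))) ⟩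
  E f N + (- c) * conv f u N + f (suc N) * (c * (H (suc (suc N)) - 0ℚ))
    ≡⟨ cong (λ t → t + (- c) * conv f u N + f (suc N) * (c * (H (suc (suc N)) - 0ℚ))) (E-exact f N) ⟩
  (P - T) + (- c) * conv f u N + f (suc N) * (c * (H (suc (suc N)) - 0ℚ))
    ≡⟨ solve 6 (λ p t c q f h → (p :- t) :+ (:- c) :* q :+ f :* (c :* (h :- con 0ℚ)) := (p :+ f :* (c :* h)) :- (t :+ c :* q)) refl
         P T c (conv f u N) (f (suc N)) (H (suc (suc N))) ⟩
  (P + f (suc N) * (c * H (suc (suc N)))) - (T + c * conv f u N) ∎
  where
  open ≡-Reasoning
  c = u (suc N)
  P = Σ< (suc N) (λ n → f n * (u n * H (suc n)))
  T = τ f u N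
  pointwise : ∀ i j → i ℕ.+ j ≡ N → f i * (u i * (H (suc (i ℕ.+ suc j)) - H (suc j))) ≡
    f i * (u i * (H (suc (i ℕ.+ j)) - H j)) + (- c) * (f i * u j)
  pointwise i j refl = begin
    f i * (u i * (H (suc (i ℕ.+ suc j)) - H (suc j)))
      ≡⟨ cong (λ m → f i * (u i * (H (suc m) - H (suc j)))) (ℕ.+-suc i j) ⟩
    f i * (u i * ((A + c) - (B + u j)))
      ≡⟨ solve 6 (λ f a A c B b → f :* (a :* ((A :+ c) :- (B :+ b))) := f :* (a :* (A :- B)) :+ (f :* (a :* c) :- f :* (a :* b)))
             refl (f i) (u i) A c B (u j) ⟩
    f i * (u i * (A - B)) + (f i * (u i * c) - f i * (u i * u j))
      ≡⟨ cong (λ t → f i * (u i * (A - B)) + (f i * (u i * c) - f i * t)) (u*u i j) ⟩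
    f i * (u i * (A - B)) + (f i * (u i * c) - f i * (c * (u i + u j)))
      ≡⟨ cong (λ t → f i * (u i * (A - B)) + t) (solve 4 (λ f a b c → f :* (a :* c) :- f :* (c :* (a :+ b)) := (:- c) :* (f :* b))
             refl (f i) (u i) (u j) c) ⟩
    f i * (u i * (A - B)) + (- c) * (f i * u j) ∎
    where
    A = H (suc (i ℕ.+ j))
    B = H j

H-gap : ∀ d n → H (d ℕ.+ n) - H n ≤ ι d * u n
H-gap zero    n = ≤-reflexive (trans (+-inverseʳ (H n)) (sym (*-zeroˡ (u n))))
H-gap (suc d) n = subst₂ _≤_
  (solve 3 (λ a b c → (a :- b) :+ c := (a :+ c) :- b) refl (H (d ℕ.+ n)) (H n) (u (d ℕ.+ n)))
  (solve 2 (λ i b → i :* b :+ b := (con 1ℚ :+ i) :* b) refl (ι d) (u n))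
  (+-mono-≤ (H-gap d n) (u-antitone d n))

H-mono : ∀ d n → H n ≤ H (d ℕ.+ n)
H-mono zero    n = ≤-refl
H-mono (suc d) n = ≤-trans (H-mono d n) (≤-from-diff (subst (0ℚ ≤_)
  (solve 2 (λ a b → b := (a :+ b) :- a) refl (H (d ℕ.+ n)) (u (d ℕ.+ n))) (u-nonneg (d ℕ.+ n))))

-- The gap consists of i + 1 reciprocals, each at most `u j`, and the factor `u i` averages them.
E-bound : ∀ {f} → (∀ i → ∣ f i ∣ ≤ u i) → ∀ N → ∣ E f N ∣ ≤ conv u u N
E-bound {f} p = ∣ad∣≤ (λ i j → subst (_≤ u i * u j) (sym (∣p*q∣≡∣p∣*∣q∣ (f i) (u i * gap i j)))
    (*-mono-≤-nonneg (0≤∣p∣ (f i)) (u-nonneg j) (p i)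
      (subst (_≤ u j) (sym (0≤p⇒∣p∣≡p (*-nonneg (u-nonneg i) (diff-nonneg (H-mono (suc i) j))))) (scaled i j))))
  where
  gap : ℕ → ℕ → ℚ
  gap i j = H (suc (i ℕ.+ j)) - H j
  scaled : ∀ i j → u i * gap i j ≤ u j
  scaled i j = subst (u i * gap i j ≤_)
    (trans (sym (*-assoc (u i) (ι (suc i)) (u j))) (trans (cong (_* u j) (uι i)) (*-identityˡ (u j))))
    (*-monoˡ-≤-nonNeg (u i) {{nonNegative (u-nonneg i)}} (H-gap (suc i) j))

-- The partial sums of the alternating series A.
Q : ℕ → ℚ
Q N = Σ< N (λ n → v n * (u n * H (suc n)))

Q≡Y+W : ∀ N → Q N ≡ Y N + W N
Q≡Y+W N = trans (Σ-cong N λ n → solve 3 (λ s a b → s :* a :* (a :* (b :+ a)) := s :* (a :* (a :* b)) :+ s :* (a :* (a :* a)))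
       refl (s n) (u n) (H n))
  (Σ-+ N _ _)

-- The two evaluations of T(1, 1) compared on a triangle; in the limit this is Euler's identity ∑
-- H_{n-1} / n^2 = ζ(3).
E-u : ∀ N → E u N ≡ Z (suc N) - X (suc N)
E-u N = trans (E-exact u N) (trans (cong₂ _-_ (trans
    (Σ-cong (suc N) λ n → solve 2 (λ a b → a :* (a :* (b :+ a)) := a :* (a :* b) :+ a :* (a :* a))
           refl (u n) (H n))
    (Σ-+ (suc N) (λ n → u n * (u n * H n)) (λ n → u n * (u n * u n)))) (τ-uu N))
  (solve 2 (λ x z → (x :+ z) :- (x :+ x) := z :- x) refl (X (suc N)) (Z (suc N))))

-- z is supported on the odd indices, which stand for the even denominators.
z : ℕ → ℚ
z n = u n - v n

s-double : ∀ a → s (double a) ≡ 1ℚ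
s-double zero    = refl
s-double (suc a) = trans (cong (λ t → - - t) (s-double a)) refl

ι-double : ∀ a → ι (double a) ≡ ι a + ι a
ι-double zero    = refl
ι-double (suc a) = trans (cong (λ t → 1ℚ + (1ℚ + t)) (ι-double a))
  (solve 1 (λ i → con 1ℚ :+ (con 1ℚ :+ (i :+ i)) := (con 1ℚ :+ i) :+ (con 1ℚ :+ i)) refl (ι a))

u-double : ∀ a → u (suc (double a)) + u (suc (double a)) ≡ u a
u-double a = inverse-unique {c = ι (suc a)} (begin
  (b + b) * ι (suc a)               ≡⟨ solve 2 (λ b i → (b :+ b) :* i := b :* (i :+ i))
         refl b (ι (suc a)) ⟩
  b * (ι (suc a) + ι (suc a))       ≡⟨ cong (b *_) (ι-double (suc a)) ⟨
  b * ι (double (suc a))            ≡⟨ uι (suc (double a)) ⟩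
  1ℚ                                ∎) (uι a)
  where
  open ≡-Reasoning
  b = u (suc (double a))

z-even : ∀ a → z (double a) ≡ 0ℚ
z-even a = trans (cong (λ t → u (double a) - t * u (double a)) (s-double a))
  (solve 1 (λ b → b :- con 1ℚ :* b := con 0ℚ) refl (u (double a)))

z-odd : ∀ a → z (suc (double a)) ≡ u a
z-odd a = trans (cong (λ t → b - (- t) * b) (s-double a))
  (trans (solve 1 (λ b → b :- (:- con 1ℚ) :* b := b :+ b) refl b) (u-double a))
  where b = u (suc (double a))

zz-left : ∀ a j → z (double a) * z j ≡ 0ℚ
zz-left a j = trans (cong (_* z j) (z-even a)) (*-zeroˡ (z j))

zz-right : ∀ i b → z i * z (double b) ≡ 0ℚ
zz-right i b = trans (cong (z i *_) (z-even b)) (*-zeroʳ (z i))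

conv-zz-even : ∀ K → conv z z (double (suc K)) ≡ conv u u K
conv-zz-even K = trans (ad-even (λ i j → z i * z j) zz-left zz-right K)
  (ad-cong K (λ a b _ → cong₂ _*_ (z-odd a) (z-odd b)))

-- For a = 2a′ and b = 2b′ the factor 1/(a + b) is half of 1/(a′ + b′), so this is half of
-- `τ u u K`.
τ-zz : ∀ K → τ z z (suc (double K)) ≡ X (suc K)
τ-zz zero    = refl
τ-zz (suc K) = begin
  (τ z z (suc (double K)) + u (double (suc K)) * conv z z (suc (double K))) + b * conv z z (double (suc K))
    ≡⟨ cong₂ _+_ (cong₂ (λ x y → x + u (double (suc K)) * y) (τ-zz K) (ad-odd (λ i j → z i * z j) zz-left zz-right K))
                 (cong (b *_) (trans (conv-zz-even K) (conv-uu K))) ⟩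
  (X (suc K) + u (double (suc K)) * 0ℚ) + b * (u (suc K) * (H (suc K) + H (suc K)))
    ≡⟨ solve 5 (λ x w b a h → (x :+ w :* con 0ℚ) :+ b :* (a :* (h :+ h)) := x :+ (b :+ b) :* (a :* h)) refl
         (X (suc K)) (u (double (suc K))) b (u (suc K)) (H (suc K)) ⟩
  X (suc K) + (b + b) * (u (suc K) * H (suc K))
    ≡⟨ cong (λ t → X (suc K) + t * (u (suc K) * H (suc K))) (u-double (suc K)) ⟩
  X (suc (suc K)) ∎
  where
  open ≡-Reasoning
  b = u (suc (double (suc K)))

conv-zz : ∀ n → conv z z n ≡ (conv u u n + conv v v n) + (- 1ℚ) * (conv v u n + conv v u n)
conv-zz n = begin
  conv z z n
    ≡⟨ ad-cong n (λ i j _ → solve 4 (λ a b c d → (a :- b) :* (c :- d) := (a :* c :+ b :* d) :+ (:- con 1ℚ) :* (b :* c :+ a :* d))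
           refl (u i) (v i) (u j) (v j)) ⟩
  ad (λ i j → (u i * u j + v i * v j) + (- 1ℚ) * (v i * u j + u i * v j)) n
    ≡⟨ ad-+ _ _ n ⟩
  ad (λ i j → u i * u j + v i * v j) n + ad (λ i j → (- 1ℚ) * (v i * u j + u i * v j)) n
    ≡⟨ cong₂ _+_ (ad-+ _ _ n) (trans (ad-* (- 1ℚ) _ n) (cong (- 1ℚ *_) (trans (ad-+ _ _ n) (cong (_+_ (conv v u n)) (conv-comm u v n))))) ⟩
  (conv u u n + conv v v n) + (- 1ℚ) * (conv v u n + conv v u n) ∎
  where open ≡-Reasoning

τ-expand : ∀ N → τ z z N ≡ (τ u u N + τ v v N) - (τ v u N + τ v u N)
τ-expand zero    = refl
τ-expand (suc N) = trans (cong₂ (λ a b → a + u (suc N) * b) (τ-expand N) (conv-zz N))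
  (solve 7 (λ a b c p q r w → ((a :+ b) :- (c :+ c)) :+ w :* ((p :+ q) :+ (:- con 1ℚ) :* (r :+ r)) :=
      ((a :+ w :* p) :+ (b :+ w :* q)) :- ((c :+ w :* r) :+ (c :+ w :* r))) refl
    (τ u u N) (τ v v N) (τ v u N) (conv u u N) (conv v v N) (conv v u N) (u (suc N)))

-- Evaluation of the alternating series

¼ : ℚ
¼ = ½ * ½

-- Flipping the even terms removes twice their sum, and 2/(2m)^3 = 1/(4m^3).
W-double : ∀ M → W (double M) ≡ Z (double M) - ¼ * Z M
W-double zero    = refl
W-double (suc M) = begin
  (W (double M) + s (double M) * (a * (a * a))) + (- s (double M)) * (b * (b * b))
    ≡⟨ cong₂ (λ w t → (w + t * (a * (a * a))) + (- t) * (b * (b * b))) (W-double M) (s-double M) ⟩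
  ((Z (double M) - ¼ * Z M) + 1ℚ * (a * (a * a))) + (- 1ℚ) * (b * (b * b))
    ≡⟨ solve 4 (λ Z Z′ a b → ((Z :- con ¼ :* Z′) :+ con 1ℚ :* (a :* (a :* a))) :+ (:- con 1ℚ) :* (b :* (b :* b)) :=
         ((Z :+ a :* (a :* a)) :+ b :* (b :* b)) :- con ¼ :* (Z′ :+ (b :+ b) :* ((b :+ b) :* (b :+ b))))
                refl (Z (double M)) (Z M) a b ⟩
  Z (double (suc M)) - ¼ * (Z M + (b + b) * ((b + b) * (b + b)))
    ≡⟨ cong (λ t → Z (double (suc M)) - ¼ * (Z M + t * (t * t))) (u-double M) ⟩
  Z (double (suc M)) - ¼ * Z (suc M) ∎
  where
  open ≡-Reasoning
  a = u (double M)
  b = u (suc (double M))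

-- The weights 1/2, -1/2 and 1/4 on the three error identities eliminate `X` and `τ v u`. With N =
-- 2K + 1, `suc N` is `double M` by definition, so all sums are cut at matching places.
Q-exact : ∀ K → let M = suc K ; N = suc (double K) in
  Q (double M) - (+ 5 / 8) * Z M ≡ (Z (double M) - Z M) + (½ * (E v N - E u N) + ¼ * E u K)
Q-exact K = begin
  Q₂ - 5/8 * Z₁
    ≡⟨ cong (λ q → q - 5/8 * Z₁) Q₂≡ ⟩
  (Y₂ + (Z₂ - ¼ * Z₁)) - 5/8 * Z₁
    ≡⟨ solve 5 (λ X₂ Y₂ Z₂ Z₁ T → (Y₂ :+ (Z₂ :- con ¼ :* Z₁)) :- con (+ 5 / 8) :* Z₁ :=
         (Z₂ :- Z₁) :+ (con ½ :* (((Y₂ :+ (Z₂ :- con ¼ :* Z₁)) :- T) :- (Z₂ :- X₂))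
           :+ con ¼ :* (Z₁ :- (((X₂ :+ X₂) :+ (:- (Y₂ :+ Y₂))) :- (T :+ T))))) refl X₂ Y₂ Z₂ Z₁ T ⟩
  (Z₂ - Z₁) + (½ * (((Y₂ + (Z₂ - ¼ * Z₁)) - T) - (Z₂ - X₂)) + ¼ * (Z₁ - (((X₂ + X₂) + - (Y₂ + Y₂)) - (T + T))))
    ≡⟨ cong (_+_ (Z₂ - Z₁)) (cong₂ (λ a b → ½ * a + ¼ * b)
         (cong₂ _-_ (trans (cong (_- T) (sym Q₂≡)) (sym (E-exact v N))) (sym (E-u N)))
         (trans (cong (λ x → Z₁ - x) X₁≡) (sym (E-u K)))) ⟩
  (Z₂ - Z₁) + (½ * (E v N - E u N) + ¼ * E u K) ∎
  where
  open ≡-Reasoning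
  M = suc K
  N = suc (double K)
  5/8 = + 5 / 8
  Q₂ = Q (double M)
  Y₂ = Y (double M)
  W₂ = W (double M)
  Z₂ = Z (double M)
  Z₁ = Z M
  X₂ = X (double M)
  T = τ v u N
  Q₂≡ : Q₂ ≡ Y₂ + (Z₂ - ¼ * Z₁)
  Q₂≡ = trans (Q≡Y+W (double M)) (cong (_+_ Y₂) (W-double M))
  -- The four choices of signs add up to the sum over even a and b.
  X₁≡ : ((X₂ + X₂) + - (Y₂ + Y₂)) - (T + T) ≡ X M
  X₁≡ = trans (cong (_- (T + T)) (sym (cong₂ _+_ (τ-uu N) (τ-vv N)))) (trans (sym (τ-expand N)) (τ-zz K))

-- Null sequences

∣p-q∣≡∣q-p∣ : ∀ p q → ∣ p - q ∣ ≡ ∣ q - p ∣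
∣p-q∣≡∣q-p∣ p q = trans (sym (∣-p∣≡∣p∣ (p - q)))
  (cong ∣_∣ (solve 2 (λ p q → :- (p :- q) := q :- p) refl p q))

p≤∣p∣ : ∀ p → p ≤ ∣ p ∣
p≤∣p∣ p with ≤-total 0ℚ p
... | inj₁ 0≤p = ≤-reflexive (sym (0≤p⇒∣p∣≡p 0≤p))
... | inj₂ p≤0 = ≤-trans p≤0 (0≤∣p∣ p)

∣q*p∣≤∣p∣ : ∀ {q} p → 0ℚ ≤ q → q ≤ 1ℚ → ∣ q * p ∣ ≤ ∣ p ∣
∣q*p∣≤∣p∣ {q} p 0≤q q≤1 = subst₂ _≤_
  (sym (trans (∣p*q∣≡∣p∣*∣q∣ q p) (cong (_* ∣ p ∣) (0≤p⇒∣p∣≡p 0≤q)))) (*-identityˡ ∣ p ∣)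
  (*-monoʳ-≤-nonNeg ∣ p ∣ {{∣-∣-nonNeg p}} q≤1)

½ε+½ε : ∀ ε → ½ * ε + ½ * ε ≡ ε
½ε+½ε = solve 1 (λ ε → con ½ :* ε :+ con ½ :* ε := ε) refl

½-pos : ∀ {ε} → 0ℚ < ε → 0ℚ < ½ * ε
½-pos {ε} p = subst (_< ½ * ε) (*-zeroʳ ½) (*-monoʳ-<-pos ½ p)

IsNull : (ℕ → ℚ) → Set
IsNull f = ∀ ε → 0ℚ < ε → ∃[ N ] ∀ n → N ℕ.≤ n → ∣ f n ∣ < ε

null-dominated : ∀ {f g : ℕ → ℚ} → (∀ n → ∣ f n ∣ ≤ ∣ g n ∣) → IsNull g → IsNull f
null-dominated p g→0 ε 0<ε = let (N , b) = g→0 ε 0<ε in N , λ n q → ≤-<-trans (p n) (b n q)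

null-+ : ∀ {f g} → IsNull f → IsNull g → IsNull (λ n → f n + g n)
null-+ {f} {g} f→0 g→0 ε 0<ε =
  let (M , a) = f→0 (½ * ε) (½-pos 0<ε)
      (N , b) = g→0 (½ * ε) (½-pos 0<ε)
  in M ℕ.⊔ N , λ n q → ≤-<-trans (∣p+q∣≤∣p∣+∣q∣ (f n) (g n))
       (subst (∣ f n ∣ + ∣ g n ∣ <_) (½ε+½ε ε)
         (+-mono-< (a n (ℕ.≤-trans (ℕ.m≤m⊔n M N) q)) (b n (ℕ.≤-trans (ℕ.m≤n⊔m M N) q))))

null-* : ∀ {f} c → 0ℚ ≤ c → c ≤ 1ℚ → IsNull f → IsNull (λ n → c * f n)
null-* {f} c 0≤c c≤1 = null-dominated (λ n → ∣q*p∣≤∣p∣ (f n) 0≤c c≤1)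

null-neg : ∀ {f} → IsNull f → IsNull (λ n → - f n)
null-neg {f} = null-dominated (λ n → ≤-reflexive (∣-p∣≡∣p∣ (f n)))

null-subsequence : ∀ {f : ℕ → ℚ} φ → (∀ n → n ℕ.≤ φ n) → IsNull f → IsNull (f ∘ φ)
null-subsequence φ p f→0 ε 0<ε = let (N , b) = f→0 ε 0<ε in N , λ n q → b (φ n) (ℕ.≤-trans q (p n))

null-unshift : ∀ {f} → IsNull (f ∘ suc) → IsNull f
null-unshift f→0 ε 0<ε = let (N , b) = f→0 ε 0<ε in suc N , λ where (suc n) (ℕ.s≤s q) → b n q

-- Squares are easier to control here: that of `u` is an increment of ζ(2), that of `u n * H n` is
-- O(1/n).
null-√ : ∀ {f} → IsNull (λ n → f n * f n) → IsNull f
null-√ {f} p ε 0<ε =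
  let 0≤ε     = <⇒≤ 0<ε
      (N , b) = p (ε * ε) (subst (_< ε * ε) (*-zeroʳ ε) (*-monoʳ-<-pos ε {{positive 0<ε}} 0<ε))
  in N , λ n q → ≰⇒> (λ ε≤∣f∣ → <-irrefl refl (<-≤-trans (b n q)
       (subst (ε * ε ≤_) (sym (∣p*q∣≡∣p∣*∣q∣ (f n) (f n)))
         (*-mono-≤-nonneg 0≤ε (0≤∣p∣ (f n)) ε≤∣f∣ ε≤∣f∣))))

null-increment : ∀ (x : ℝ) (φ : ℕ → ℕ) → (∀ n → n ℕ.≤ φ n) → IsNull (λ n → seq x (φ n) - seq x n)
null-increment x φ p ε 0<ε = let (N , b) = cauchy x ε 0<ε in N , λ n q → b (φ n) n (ℕ.≤-trans q (p n)) q

1/suc^suc : ∀ m n → 1/ suc m ^ suc n ≡ u m * 1/ suc m ^ n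
1/suc^suc m n = 1/ℕ-* (suc m) (suc m ℕ.^ n) {{_}} {{ℕ.m^n≢0 (suc m) n}}

1/suc^2 : ∀ m → 1/ suc m ^ 2 ≡ u m * u m
1/suc^2 m = trans (1/suc^suc m 1) (cong (u m *_) (trans (1/suc^suc m 0) (*-identityʳ (u m))))

1/suc^3 : ∀ m → 1/ suc m ^ 3 ≡ u m * (u m * u m)
1/suc^3 m = trans (1/suc^suc m 2) (cong (u m *_) (1/suc^2 m))

zetaSum3≡Z : ∀ n → zetaSum 3 n ≡ Z n
zetaSum3≡Z zero    = refl
zetaSum3≡Z (suc n) = cong₂ _+_ (zetaSum3≡Z n) (1/suc^3 n)

-- u² tends to 0 since the partial sums of ζ 2 form a Cauchy sequence.
null-u : IsNull u
null-u = null-√ (null-dominated (λ n → ≤-reflexive (cong ∣_∣ (sym (begin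
    zetaSum 2 (suc n) - zetaSum 2 n     ≡⟨ solve 2 (λ a b → (a :+ b) :- a := b)
           refl (zetaSum 2 n) (1/ suc n ^ 2) ⟩
    1/ suc n ^ 2                        ≡⟨ 1/suc^2 n ⟩
    u n * u n                           ∎))))
  (null-increment (ζ 2) suc ℕ.n≤1+n))
  where open ≡-Reasoning

-- Growth of harmonic numbers and decay of the errors

H-nonneg : ∀ n → 0ℚ ≤ H n
H-nonneg n = Σ-nonneg n u-nonneg

H≤ι : ∀ n → H n ≤ ι n
H≤ι zero    = ≤-refl
H≤ι (suc n) = ≤-trans (+-mono-≤ (H≤ι n) (u≤1 n)) (≤-reflexive (+-comm (ι n) 1ℚ))

uι≤1 : ∀ n → u n * ι n ≤ 1ℚ
uι≤1 n = subst (u n * ι n ≤_) (uι n) (*-monoˡ-≤-nonNeg (u n) {{nonNegative (u-nonneg n)}}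
  (≤-from-diff (subst (0ℚ ≤_) (solve 1 (λ i → con 1ℚ := (con 1ℚ :+ i) :- i) refl (ι n)) 0≤1)))

uH≤1 : ∀ n → u n * H n ≤ 1ℚ
uH≤1 n = ≤-trans (*-monoˡ-≤-nonNeg (u n) {{nonNegative (u-nonneg n)}} (H≤ι n)) (uι≤1 n)

-- A crude substitute for logarithmic growth: a step adds 2 `u n * H n` + `u n * u n`, which is at
-- most 3.
H²≤3n : ∀ n → H n * H n ≤ ι n + ι n + ι n
H²≤3n zero    = ≤-refl
H²≤3n (suc n) = subst₂ _≤_
  (solve 2 (λ a b → a :* a :+ b :* a :+ b :* a :+ b :* b := (a :+ b) :* (a :+ b)) refl (H n) (u n))
  (solve 1 (λ i → i :+ i :+ i :+ con 1ℚ :+ con 1ℚ :+ con 1ℚ :* con 1ℚ :=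
      (con 1ℚ :+ i) :+ (con 1ℚ :+ i) :+ (con 1ℚ :+ i)) refl (ι n))
  (+-mono-≤ (+-mono-≤ (+-mono-≤ (H²≤3n n) (uH≤1 n)) (uH≤1 n))
    (*-mono-≤-nonneg (u-nonneg n) 0≤1 (u≤1 n) (u≤1 n)))

null-uH : IsNull (λ n → u n * H n)
null-uH = null-√ (null-dominated (λ n → subst₂ _≤_
      (sym (0≤p⇒∣p∣≡p (*-nonneg (uH-nonneg n) (uH-nonneg n))))
      (sym (0≤p⇒∣p∣≡p (+-nonneg (+-nonneg (u-nonneg n) (u-nonneg n)) (u-nonneg n))))
      (≤-trans (bound n) (≤-reflexive (*-identityʳ (u n + u n + u n)))))
    (null-+ (null-+ null-u null-u) null-u))
  where
  uH-nonneg : ∀ n → 0ℚ ≤ u n * H n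
  uH-nonneg n = *-nonneg (u-nonneg n) (H-nonneg n)
  bound : ∀ n → (u n * H n) * (u n * H n) ≤ (u n + u n + u n) * 1ℚ
  bound n = subst (_≤ (u n + u n + u n) * 1ℚ)
    (solve 2 (λ a b → a :* a :* (b :* b) := (a :* b) :* (a :* b)) refl (u n) (H n))
    (≤-trans (*-monoˡ-≤-nonNeg (u n * u n) {{nonNegative (*-nonneg (u-nonneg n) (u-nonneg n))}} (H²≤3n n))
      (subst (_≤ (u n + u n + u n) * 1ℚ)
        (solve 2 (λ a i → (a :+ a :+ a) :* (a :* i) := a :* a :* (i :+ i :+ i)) refl (u n) (ι n))
        (*-monoˡ-≤-nonNeg (u n + u n + u n)
          {{nonNegative (+-nonneg (+-nonneg (u-nonneg n) (u-nonneg n)) (u-nonneg n))}} (uι≤1 n))))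

null-E : ∀ {f} → (∀ i → ∣ f i ∣ ≤ u i) → IsNull (E f)
null-E {f} p = null-dominated {g = λ n → u (suc n) * H (suc n) + u (suc n) * H (suc n)}
  (λ n → ≤-trans (E-bound p n) (≤-trans (≤-reflexive (trans (conv-uu n)
            (*-distribˡ-+ (u (suc n)) (H (suc n)) (H (suc n)))))
          (p≤∣p∣ (u (suc n) * H (suc n) + u (suc n) * H (suc n)))))
  (null-+ null-uH′ null-uH′)
  where
  null-uH′ : IsNull (λ n → u (suc n) * H (suc n))
  null-uH′ = null-subsequence suc ℕ.n≤1+n null-uH

null-Eu : IsNull (E u)
null-Eu = null-E (λ i → ≤-reflexive (0≤p⇒∣p∣≡p (u-nonneg i)))

null-Ev : IsNull (E v)
null-Ev = null-E (λ i → ≤-reflexive (trans (∣p*q∣≡∣p∣*∣q∣ (s i) (u i))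
  (trans (cong₂ _*_ (∣s∣≡1 i) (0≤p⇒∣p∣≡p (u-nonneg i))) (*-identityˡ (u i)))))

-- Half of 1/(n + 1) is at most 1/(n + 2), by `u-step` and `u≤1`.
h≤u : ∀ n → h n ≤ u n
h≤u zero    = ≤-refl
h≤u (suc n) = ≤-trans (*-monoˡ-≤-nonNeg ½ (h≤u n)) (subst₂ _≤_
  (trans (cong (½ *_) (+-comm (u (suc n)) (u (suc n) * u n))) (cong (½ *_) (sym (u-step n))))
  (½ε+½ε (u (suc n)))
  (≤-trans (*-monoˡ-≤-nonNeg ½ (+-monoʳ-≤ (u (suc n)) (subst (u (suc n) * u n ≤_) (*-identityʳ (u (suc n)))
      (*-monoˡ-≤-nonNeg (u (suc n)) {{nonNegative (u-nonneg (suc n))}} (u≤1 n)))))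
    (≤-reflexive (*-distribˡ-+ ½ (u (suc n)) (u (suc n))))))

null-h : IsNull h
null-h = null-dominated (λ n → ≤-trans (≤-reflexive (0≤p⇒∣p∣≡p (h-nonneg n))) (≤-trans (h≤u n) (p≤∣p∣ (u n)))) null-u

n≤double : ∀ n → n ℕ.≤ double n
n≤double zero    = ℕ.z≤n
n≤double (suc n) = ℕ.s≤s (ℕ.m≤n⇒m≤1+n (n≤double n))

null-Q : IsNull (λ K → Q (double (suc K)) - (+ 5 / 8) * Z (suc K))
null-Q = null-dominated (λ K → ≤-reflexive (cong ∣_∣ (Q-exact K)))
  (null-+ null-Z (null-+ (null-* ½ (nonNegative⁻¹ ½) (≤ᵇ⇒≤ _)
      (null-+ (null-subsequence (suc ∘ double) n≤1+double null-Ev)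
              (null-neg (null-subsequence (suc ∘ double) n≤1+double null-Eu))))
    (null-* ¼ (nonNegative⁻¹ ¼) (≤ᵇ⇒≤ _) null-Eu)))
  where
  n≤1+double : ∀ n → n ℕ.≤ suc (double n)
  n≤1+double n = ℕ.m≤n⇒m≤1+n (n≤double n)
  null-Z : IsNull (λ K → Z (double (suc K)) - Z (suc K))
  null-Z = null-dominated (λ K → ≤-reflexive (cong ∣_∣ (sym (cong₂ _-_ (zetaSum3≡Z (double (suc K))) (zetaSum3≡Z (suc K))))))
    (null-subsequence {λ n → zetaSum 3 (double n) - zetaSum 3 n} suc ℕ.n≤1+n (null-increment (ζ 3) double n≤double))

-- By D-column, S N is the partial sum of ∑_j H_j^{(2)} / (j 2^j).
S : ℕ → ℚ
S N = Σ< N (λ n → h (suc n) * D n 0)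

D-row≤u : ∀ k → D 0 k ≤ u k
D-row≤u k = ≤-trans (≤-reflexive (D-row k)) (subst (u k * (u k * H (suc k)) ≤_) (*-identityʳ (u k))
  (*-monoˡ-≤-nonNeg (u k) {{nonNegative (u-nonneg k)}}
    (subst (u k * H (suc k) ≤_) (uι k) (*-monoˡ-≤-nonNeg (u k) {{nonNegative (u-nonneg k)}} (H≤ι (suc k))))))

Q≡alternating : ∀ K → Q K ≡ alternating (D 0) K
Q≡alternating K = Σ-cong K λ n → trans (*-assoc (s n) (u n) (u n * H (suc n))) (cong (s n *_) (sym (D-row n)))

-- The transform of length M is compared with the alternating sum of length 2M, the one that
-- `null-Q` evaluates.
null-S-Q : IsNull (λ K → S (suc K) - Q (double (suc K)))
null-S-Q = null-subsequence {λ M → S M - Q (double M)} suc ℕ.n≤1+n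
  (null-dominated (λ M → subst (λ q → ∣ S M - q ∣ ≤ ∣ h M + u (double M) ∣) (sym (Q≡alternating (double M)))
      (≤-trans (euler-bound D-additive D-nonneg (≤-trans (D-row≤u 0) ≤-refl) M (double M))
        (≤-trans (+-monoʳ-≤ (h M) (D-row≤u (double M))) (p≤∣p∣ (h M + u (double M))))))
    (null-+ null-h (null-subsequence double n≤double null-u)))

null-S : IsNull (λ n → S n - (+ 5 / 8) * Z n)
null-S = null-unshift (null-dominated (λ K → ≤-reflexive (cong ∣_∣
    (solve 3 (λ S Q Z → S :- Z := (S :- Q) :+ (Q :- Z))
           refl (S (suc K)) (Q (double (suc K))) ((+ 5 / 8) * Z (suc K)))))
  (null-+ null-S-Q null-Q))

-- Passage to the iterated series

β : ℕ → ℚ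
β j = u j * h (suc j)

-- The partial sums of the series ∑ 1/(j 2^j) for log 2.
B : ℕ → ℚ
B n = Σ< n β

β-nonneg : ∀ j → 0ℚ ≤ β j
β-nonneg j = *-nonneg (u-nonneg j) (h-nonneg (suc j))

B-mono : ∀ d n → 0ℚ ≤ B (d ℕ.+ n) - B n
B-mono zero    n = ≤-reflexive (sym (+-inverseʳ (B n)))
B-mono (suc d) n = subst (0ℚ ≤_)
  (solve 3 (λ x y b → (x :- y) :+ b := (x :+ b) :- y) refl (B (d ℕ.+ n)) (B n) (β (d ℕ.+ n)))
  (+-nonneg (B-mono d n) (β-nonneg (d ℕ.+ n)))

-- A new term is at most `h (suc m)`, which is exactly what `h` loses in that step, so `B + h` never
-- increases.
B-tail : ∀ d n → B (d ℕ.+ n) + h (d ℕ.+ n) ≤ B n + h n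
B-tail zero    n = ≤-refl
B-tail (suc d) n = ≤-trans (subst (B m + β m + h (suc m) ≤_)
    (solve 2 (λ b h → b :+ con ½ :* h :+ con ½ :* h := b :+ h) refl (B m) (h m))
    (+-monoˡ-≤ (h (suc m)) (+-monoʳ-≤ (B m) (subst (β m ≤_) (*-identityˡ (h (suc m)))
      (*-monoʳ-≤-nonNeg (h (suc m)) {{nonNegative (h-nonneg (suc m))}} (u≤1 m))))))
  (B-tail d n)
  where m = d ℕ.+ n

B-gap : ∀ {m n} → n ℕ.≤ m → ∣ B m - B n ∣ ≤ h n
B-gap {m} {n} n≤m = subst (λ m → ∣ B m - B n ∣ ≤ h n) (ℕ.m∸n+n≡m n≤m)
  (subst (_≤ h n) (sym (0≤p⇒∣p∣≡p (B-mono δ n))) (≤-from-diff (subst (0ℚ ≤_)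
    (solve 4 (λ b h b′ h′ → (b :+ h :- (b′ :+ h′)) :+ h′ := h :- (b′ :- b))
           refl (B n) (h n) (B (δ ℕ.+ n)) (h (δ ℕ.+ n)))
    (+-nonneg (diff-nonneg (B-tail δ n)) (h-nonneg (δ ℕ.+ n))))))
  where δ = m ℕ.∸ n

B-cauchy : IsCauchy B
B-cauchy ε 0<ε = let (N , b) = null-h ε 0<ε in N , λ m n p q → case-≤ b (ℕ.≤-total n m) p q
  where
  case-≤ : ∀ {N m n} → (∀ n → N ℕ.≤ n → ∣ h n ∣ < ε) → n ℕ.≤ m ⊎ m ℕ.≤ n → N ℕ.≤ m → N ℕ.≤ n → ∣ B m - B n ∣ < ε
  case-≤ {n = n} b (inj₁ n≤m) _ q = ≤-<-trans (≤-trans (B-gap n≤m) (p≤∣p∣ (h n))) (b n q)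
  case-≤ {m = m} {n} b (inj₂ m≤n) p _ = subst (_< ε) (∣p-q∣≡∣q-p∣ (B n) (B m))
    (≤-<-trans (≤-trans (B-gap m≤n) (p≤∣p∣ (h m))) (b m p))

Bᴿ : ℝ
Bᴿ = mkℝ B B-cauchy

-- Measuring every inner series by the same sequence B makes the double sum collapse to S by
-- summation by parts (for m < k the m-th approximation is negative).
inner : ℕ → ℝ
inner k = (u k * u k) · (Bᴿ -ᴿ fromℚ (B k))

h≡1/2^ : ∀ n → 1/ 2 ^ n ≡ h n
h≡1/2^ zero    = refl
h≡1/2^ (suc n) = trans (1/suc^suc 1 n) (cong (½ *_) (h≡1/2^ n))

summand-suc : ∀ k j → summand (suc k) (suc j) ≡ (u k * u k) * β j
summand-suc k j = cong₂ _*_ (1/suc^2 k)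
  (trans (1/ℕ-* (suc j) (2 ℕ.^ suc j) {{_}} {{ℕ.m^n≢0 2 (suc j)}}) (cong (u j *_) (h≡1/2^ (suc j))))

Σ-β : ∀ k n → Σ< n (λ i → β (k ℕ.+ i)) ≡ B (n ℕ.+ k) - B k
Σ-β k zero    = sym (+-inverseʳ (B k))
Σ-β k (suc n) = trans (cong₂ _+_ (Σ-β k n) (cong β (ℕ.+-comm k n)))
  (solve 3 (λ x y b → (x :- y) :+ b := (x :+ b) :- y) refl (B (n ℕ.+ k)) (B k) (β (n ℕ.+ k)))

seq-partialSum : ∀ a n m → seq (partialSum a n) m ≡ Σ< n (λ k → seq (a k) m)
seq-partialSum a zero    m = refl
seq-partialSum a (suc n) m = cong (_+ seq (a n) m) (seq-partialSum a n m)

-- `_<ᴿ_` demands a uniform positive gap: an estimate by ε/2 leaves the other half for it.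
hasSum-from-seq : ∀ a x → (∀ ε → 0ℚ < ε → ∃[ N ] ∀ n → N ℕ.≤ n → ∃[ M ] ∀ m → M ℕ.≤ m →
    ∣ Σ< n (λ k → seq (a k) m) - seq x m ∣ < ε) → HasSum a x
hasSum-from-seq a x p ε 0<ε =
  let (N , p₁) = p (½ * ε) (½-pos 0<ε)
  in N , λ n N≤n → let (M , p₂) = p₁ n N≤n in
    ½ * ε , ½-pos 0<ε , M , λ m M≤m → subst₂ _≤_
      (cong (λ t → ∣ t - seq x m ∣ + ½ * ε) (sym (seq-partialSum a n m))) (½ε+½ε ε)
      (+-monoˡ-≤ (½ * ε) (<⇒≤ (p₂ m M≤m)))

u²-nonneg : ∀ k → 0ℚ ≤ u k * u k
u²-nonneg k = *-nonneg (u-nonneg k) (u-nonneg k)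

u²≤1 : ∀ k → u k * u k ≤ 1ℚ
u²≤1 k = *-mono-≤-nonneg (u-nonneg k) 0≤1 (u≤1 k) (u≤1 k)

inner-hasSum : ∀ k → HasSum (λ i → fromℚ (summand (suc k) (suc k ℕ.+ i))) (inner k)
inner-hasSum k = hasSum-from-seq (λ i → fromℚ (summand (suc k) (suc k ℕ.+ i))) (inner k) λ ε 0<ε → let (N , b) = B-cauchy ε 0<ε in
  N , λ n N≤n → N , λ m N≤m → subst (_< ε) (cong ∣_∣ (sym (difference n m)))
    (≤-<-trans (∣q*p∣≤∣p∣ (B (n ℕ.+ k) - B m) (u²-nonneg k) (u²≤1 k))
      (b (n ℕ.+ k) m (ℕ.≤-trans N≤n (ℕ.m≤m+n n k)) N≤m))
  where
  open ≡-Reasoning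
  c = u k * u k
  difference : ∀ n m → Σ< n (λ i → summand (suc k) (suc k ℕ.+ i)) - c * (B m - B k) ≡ c * (B (n ℕ.+ k) - B m)
  difference n m = begin
    Σ< n (λ i → summand (suc k) (suc k ℕ.+ i)) - c * (B m - B k)
      ≡⟨ cong (_- c * (B m - B k)) (trans (Σ-cong n (λ i → summand-suc k (k ℕ.+ i))) (Σ-* n c (λ i → β (k ℕ.+ i)))) ⟩
    c * Σ< n (λ i → β (k ℕ.+ i)) - c * (B m - B k)
      ≡⟨ cong (λ t → c * t - c * (B m - B k)) (Σ-β k n) ⟩
    c * (B (n ℕ.+ k) - B k) - c * (B m - B k)
      ≡⟨ solve 4 (λ c x y z → c :* (x :- y) :- c :* (z :- y) := c :* (x :- z))
             refl c (B (n ℕ.+ k)) (B k) (B m) ⟩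
    c * (B (n ℕ.+ k) - B m) ∎

-- Going to n + 1 takes `β n` out of the brackets of all k ≤ n at once. This gives
-- `G (suc n) * β n`, the next term of `S`, and is the finite form of summing over k first.
Σ-inner : ∀ m n → Σ< n (λ k → (u k * u k) * (B m - B k)) ≡ S n + G n * (B m - B n)
Σ-inner m zero    = solve 1 (λ x → con 0ℚ := con 0ℚ :+ con 0ℚ :* x) refl (B m - 0ℚ)
Σ-inner m (suc n) = begin
  Σ< n (λ k → (u k * u k) * (B m - B k)) + a * a * (B m - B n)
    ≡⟨ cong (_+ a * a * (B m - B n)) (Σ-inner m n) ⟩
  (S n + G n * (B m - B n)) + a * a * (B m - B n)
    ≡⟨ solve 6 (λ s g b b′ a h → (s :+ g :* (b :- b′)) :+ a :* a :* (b :- b′) :=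
         (s :+ h :* (a :* (g :+ a :* a))) :+ (g :+ a :* a) :* (b :- (b′ :+ a :* h)))
                refl (S n) (G n) (B m) (B n) a (h (suc n)) ⟩
  (S n + h (suc n) * (a * G (suc n))) + G (suc n) * (B m - B (suc n))
    ≡⟨ cong (λ t → (S n + h (suc n) * t) + G (suc n) * (B m - B (suc n))) (D-column n) ⟨
  S (suc n) + G (suc n) * (B m - B (suc n)) ∎
  where
  open ≡-Reasoning
  a = u n

-- Telescoping: the square of 1/(n + 2) is at most 1/(n + 1) - 1/(n + 2).
G+u≤2 : ∀ n → G (suc n) + u n ≤ 1ℚ + 1ℚ
G+u≤2 zero    = ≤-refl
G+u≤2 (suc n) = ≤-trans (subst (G (suc (suc n)) + b ≤_) (begin
      (g + b * u n) + b           ≡⟨ +-assoc g (b * u n) b ⟩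
      g + (b * u n + b)           ≡⟨ cong (_+_ g) (u-step n) ⟨
      g + u n                     ∎)
    (+-monoˡ-≤ b (+-monoʳ-≤ g (*-monoˡ-≤-nonNeg b {{nonNegative (u-nonneg (suc n))}} (u-suc≤ n)))))
  (G+u≤2 n)
  where
  open ≡-Reasoning
  g = G (suc n)
  b = u (suc n)

G-nonneg : ∀ n → 0ℚ ≤ G n
G-nonneg n = Σ-nonneg n u²-nonneg

G≤2 : ∀ n → G n ≤ 1ℚ + 1ℚ
G≤2 zero    = ≤ᵇ⇒≤ _
G≤2 (suc n) = ≤-trans (≤-from-diff (subst (0ℚ ≤_) (solve 2 (λ g u → u := (g :+ u) :- g)
       refl (G (suc n)) (u n)) (u-nonneg n))) (G+u≤2 n)

∣G*p∣≤ : ∀ n p → ∣ G n * p ∣ ≤ ∣ p ∣ + ∣ p ∣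
∣G*p∣≤ n p = subst₂ _≤_
  (sym (trans (∣p*q∣≡∣p∣*∣q∣ (G n) p) (cong (_* ∣ p ∣) (0≤p⇒∣p∣≡p (G-nonneg n)))))
  (solve 1 (λ x → (con 1ℚ :+ con 1ℚ) :* x := x :+ x) refl ∣ p ∣)
  (*-monoʳ-≤-nonNeg ∣ p ∣ {{∣-∣-nonNeg p}} (G≤2 n))

outer-hasSum : HasSum inner ((+ 5 / 8) · ζ 3)
outer-hasSum = hasSum-from-seq inner ((+ 5 / 8) · ζ 3) λ ε 0<ε →
  -- A quarter of ε goes to `null-S`, one to the increment of ζ(3), and two to the increment of `B`,
  -- whose coefficient `G n` is at most 2.
  let 0<η = ½-pos (½-pos 0<ε)
      (N₁ , b₁) = null-S (½ * (½ * ε)) 0<η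
      (N₂ , b₂) = cauchy (ζ 3) (½ * (½ * ε)) 0<η
      (N₃ , b₃) = B-cauchy (½ * (½ * ε)) 0<η
      N = N₁ ℕ.⊔ (N₂ ℕ.⊔ N₃)
      ≥N₂ = ℕ.≤-trans (ℕ.m≤m⊔n N₂ N₃) (ℕ.m≤n⊔m N₁ (N₂ ℕ.⊔ N₃))
      ≥N₃ = ℕ.≤-trans (ℕ.m≤n⊔m N₂ N₃) (ℕ.m≤n⊔m N₁ (N₂ ℕ.⊔ N₃))
  in N , λ n N≤n → N , λ m N≤m →
    let s₁ = b₁ n (ℕ.≤-trans (ℕ.m≤m⊔n N₁ (N₂ ℕ.⊔ N₃)) N≤n)
        s₂ = b₂ n m (ℕ.≤-trans ≥N₂ N≤n) (ℕ.≤-trans ≥N₂ N≤m)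
        s₃ = b₃ m n (ℕ.≤-trans ≥N₃ N≤m) (ℕ.≤-trans ≥N₃ N≤n)
    in ≤-<-trans (bound n m)
         (subst (_ <_) (quarters ε) (+-mono-< (+-mono-< s₁ s₂) (+-mono-< s₃ s₃)))
  where
  5/8 = + 5 / 8
  quarters : ∀ ε → (½ * (½ * ε) + ½ * (½ * ε)) + (½ * (½ * ε) + ½ * (½ * ε)) ≡ ε
  quarters = solve 1 (λ ε → let q = con ½ :* (con ½ :* ε) in (q :+ q) :+ (q :+ q) := ε) refl
  difference : ∀ n m → Σ< n (λ k → seq (inner k) m) - 5/8 * zetaSum 3 m ≡
    ((S n - 5/8 * Z n) + 5/8 * (zetaSum 3 n - zetaSum 3 m)) + G n * (B m - B n)
  difference n m = trans (cong (_- 5/8 * zetaSum 3 m) (Σ-inner m n))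
    (trans (solve 5 (λ s g q z z′ → (s :+ g) :- q :* z′ := ((s :- q :* z) :+ q :* (z :- z′)) :+ g) refl
              (S n) (G n * (B m - B n)) 5/8 (zetaSum 3 n) (zetaSum 3 m))
      (cong (λ t → ((S n - 5/8 * t) + 5/8 * (zetaSum 3 n - zetaSum 3 m)) + G n * (B m - B n)) (zetaSum3≡Z n)))
  bound : ∀ n m → ∣ Σ< n (λ k → seq (inner k) m) - 5/8 * zetaSum 3 m ∣ ≤
    (∣ S n - 5/8 * Z n ∣ + ∣ zetaSum 3 n - zetaSum 3 m ∣) + (∣ B m - B n ∣ + ∣ B m - B n ∣)
  bound n m = subst (_≤ (∣ S n - 5/8 * Z n ∣ + ∣ zetaSum 3 n - zetaSum 3 m ∣) + (∣ B m - B n ∣ + ∣ B m - B n ∣))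
    (cong ∣_∣ (sym (difference n m)))
    (≤-trans (∣p+q∣≤∣p∣+∣q∣ (p₁ + p₂) p₃)
      (+-mono-≤ (≤-trans (∣p+q∣≤∣p∣+∣q∣ p₁ p₂)
          (+-monoʳ-≤ ∣ p₁ ∣ (∣q*p∣≤∣p∣ (zetaSum 3 n - zetaSum 3 m) (nonNegative⁻¹ 5/8) (≤ᵇ⇒≤ _))))
        (∣G*p∣≤ n (B m - B n))))
    where
    p₁ = S n - 5/8 * Z n
    p₂ = 5/8 * (zetaSum 3 n - zetaSum 3 m)
    p₃ = G n * (B m - B n)

corollary6p2 : HasIteratedSum (λ k i → fromℚ (summand (suc k) (suc k ℕ.+ i))) ((+ 5 / 8) · ζ 3)
corollary6p2 = inner , inner-hasSum , outer-hasSum
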